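{- Let $c \geq 2$ be a fixed integer. Then there exist a constant $L = L(c) > 0$, depending only on $c$, and an integer $n_0 = n_0(c)$ such that for all $n \geq n_0$, $$X_{\leq (c-1)}^{(c)}(n) \geq L n^2.$$
   Context: A finite set of points in $\mathbb{R}^2$ is in general position if no three of its points lie on a line. A $c$-colored point set is a finite set $P \subset \mathbb{R}^2$ together with an arbitrary assignment of a color from $\{1,2,\ldots,c\}$ to each point of $P$. A triangle determined by $P$ is a triangle whose three vertices are points of $P$; it is monochromatic if its three vertices have the same color. For a finite $c$-colored point set $P \subset \mathbb{R}^2$ in general position and an integer $s \geq 0$, $X_{\leq s}^{(c)}(P)$ denotes the number of monochromatic triangles determined by $P$ that contain at most $s$ points of $P$ (of any color) in their interior. Define $$X_{\leq s}^{(c)}(n) := \min_{P} X_{\leq s}^{(c)}(P),$$ where the minimum is over all $c$-colored point sets $P \subset \mathbb{R}^2$ in general position with $|P| = n$. -}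

module Defs where

open import Data.Nat as ℕ using (ℕ; suc)
import Data.Nat.Properties as ℕₚ
open import Data.Integer using (+_)
open import Data.Rational as ℚ using (ℚ; 0ℚ; 1ℚ; ½)
import Data.Rational.Properties as ℚₚ
open import Data.Rational.Solver using (module +-*-Solver)
open import Data.Fin as Fin using (Fin)
open import Data.List using (List; []; _∷_; length; filter; allFin; cartesianProduct)
open import Data.List.Membership.Propositional using (_∈_)
open import Data.List.Membership.Propositional.Properties
  using (∈-filter⁺; ∈-filter⁻; ∈-cartesianProduct⁺; ∈-allFin)
open import Data.List.Relation.Unary.All as All using (All; []; _∷_)
open import Data.List.Relation.Unary.Unique.Propositional using (Unique)
import Data.List.Relation.Unary.Unique.Propositional.Properties as Unique
open import Data.Product using (Σ; ∃; _×_; _,_; proj₁; proj₂)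
open import Function using (_∘_)
open import Function.Bundles using (_⇔_; mk⇔)
open import Level using (Level)
open import Relation.Binary.PropositionalEquality
open import Relation.Nullary using (¬_; Dec; yes; no)
open import Relation.Unary using (Pred)

open +-*-Solver using (solve; _:=_; _:+_; _:*_; :-_)

private
  variable
    ℓ : Level

------------------------------------------------------------------------
-- Real numbers as Cauchy sequences of rationals, with the setoid
-- equality _≈_.  All operations act termwise.

IsCauchy : (ℕ → ℚ) → Set
IsCauchy f = ∀ ε → 0ℚ ℚ.< ε →
  ∃ λ N → ∀ m n → N ℕ.≤ m → N ℕ.≤ n → ℚ.∣ f m ℚ.- f n ∣ ℚ.< ε

record ℝ : Set where
  constructor mkℝ
  field
    seq    : ℕ → ℚ
    cauchy : IsCauchy seq

open ℝ public

private abstract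

  half-pos : ∀ {ε} → 0ℚ ℚ.< ε → 0ℚ ℚ.< ½ ℚ.* ε
  half-pos {ε} 0<ε = subst (ℚ._< ½ ℚ.* ε) (ℚₚ.*-zeroʳ ½) (ℚₚ.*-monoʳ-<-pos ½ 0<ε)

  halves : ∀ ε → ½ ℚ.* ε ℚ.+ ½ ℚ.* ε ≡ ε
  halves ε = trans (sym (ℚₚ.*-distribʳ-+ ε ½ ½)) (ℚₚ.*-identityˡ ε)

  const-cauchy : ∀ q → IsCauchy (λ _ → q)
  const-cauchy q ε 0<ε = 0 , λ _ _ _ _ →
    subst (λ r → ℚ.∣ r ∣ ℚ.< ε) (sym (ℚₚ.+-inverseʳ q)) 0<ε

  +-cauchy : ∀ {f g} → IsCauchy f → IsCauchy g → IsCauchy (λ n → f n ℚ.+ g n)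
  +-cauchy {f} {g} cf cg ε 0<ε
    with M , hf ← cf (½ ℚ.* ε) (half-pos 0<ε)
       | N , hg ← cg (½ ℚ.* ε) (half-pos 0<ε) =
    M ℕ.⊔ N , λ m n m≥ n≥ → begin-strict
      ℚ.∣ (f m ℚ.+ g m) ℚ.- (f n ℚ.+ g n) ∣
        ≡⟨ cong ℚ.∣_∣ (regroup (f m) (g m) (f n) (g n)) ⟩
      ℚ.∣ (f m ℚ.- f n) ℚ.+ (g m ℚ.- g n) ∣
        ≤⟨ ℚₚ.∣p+q∣≤∣p∣+∣q∣ (f m ℚ.- f n) (g m ℚ.- g n) ⟩
      ℚ.∣ f m ℚ.- f n ∣ ℚ.+ ℚ.∣ g m ℚ.- g n ∣
        <⟨ ℚₚ.+-mono-< (hf m n (ℕₚ.m⊔n≤o⇒m≤o M N m≥) (ℕₚ.m⊔n≤o⇒m≤o M N n≥))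
                       (hg m n (ℕₚ.m⊔n≤o⇒n≤o M N m≥) (ℕₚ.m⊔n≤o⇒n≤o M N n≥)) ⟩
      ½ ℚ.* ε ℚ.+ ½ ℚ.* ε
        ≡⟨ halves ε ⟩
      ε ∎
    where
    open ℚₚ.≤-Reasoning
    regroup : ∀ a b c d → (a ℚ.+ b) ℚ.- (c ℚ.+ d) ≡ (a ℚ.- c) ℚ.+ (b ℚ.- d)
    regroup = solve 4 (λ a b c d →
      (a :+ b) :+ :- (c :+ d) := (a :+ :- c) :+ (b :+ :- d)) refl

  neg-cauchy : ∀ {f} → IsCauchy f → IsCauchy (λ n → ℚ.- f n)
  neg-cauchy {f} cf ε 0<ε with N , h ← cf ε 0<ε =
    N , λ m n m≥ n≥ → subst (ℚ._< ε) (flip m n) (h m n m≥ n≥)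
    where
    negate : ∀ a b → ℚ.- (a ℚ.- b) ≡ ℚ.- a ℚ.- ℚ.- b
    negate = solve 2 (λ a b → :- (a :+ :- b) := :- a :+ :- (:- b)) refl
    flip : ∀ m n → ℚ.∣ f m ℚ.- f n ∣ ≡ ℚ.∣ ℚ.- f m ℚ.- ℚ.- f n ∣
    flip m n = trans (sym (ℚₚ.∣-p∣≡∣p∣ (f m ℚ.- f n)))
                     (cong ℚ.∣_∣ (negate (f m) (f n)))

  0<1 : 0ℚ ℚ.< 1ℚ
  0<1 = ℚₚ.positive⁻¹ 1ℚ

  eventually-bounded : ∀ {f} → IsCauchy f →
    ∃ λ B → 0ℚ ℚ.< B × ∃ λ N → ∀ n → N ℕ.≤ n → ℚ.∣ f n ∣ ℚ.≤ B
  eventually-bounded {f} cf with N , h ← cf 1ℚ 0<1 =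
    1ℚ ℚ.+ ℚ.∣ f N ∣ ,
    ℚₚ.+-mono-<-≤ 0<1 (ℚₚ.0≤∣p∣ (f N)) ,
    N , λ n n≥ → begin
      ℚ.∣ f n ∣                        ≡⟨ cong ℚ.∣_∣ (split (f n) (f N)) ⟩
      ℚ.∣ (f n ℚ.- f N) ℚ.+ f N ∣      ≤⟨ ℚₚ.∣p+q∣≤∣p∣+∣q∣ (f n ℚ.- f N) (f N) ⟩
      ℚ.∣ f n ℚ.- f N ∣ ℚ.+ ℚ.∣ f N ∣  ≤⟨ ℚₚ.+-monoˡ-≤ ℚ.∣ f N ∣
                                           (ℚₚ.<⇒≤ (h n N n≥ ℕₚ.≤-refl)) ⟩
      1ℚ ℚ.+ ℚ.∣ f N ∣                 ∎
    where
    open ℚₚ.≤-Reasoning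
    split : ∀ a b → a ≡ (a ℚ.- b) ℚ.+ b
    split = solve 2 (λ a b → a := (a :+ :- b) :+ b) refl

  distribute : ∀ b c e i →
    b ℚ.* (e ℚ.* i) ℚ.+ (e ℚ.* i) ℚ.* c ≡ e ℚ.* (i ℚ.* (b ℚ.+ c))
  distribute = solve 4 (λ b c e i →
    b :* (e :* i) :+ (e :* i) :* c := e :* (i :* (b :+ c))) refl

  *-regroup : ∀ a b c d →
    a ℚ.* b ℚ.- c ℚ.* d ≡ a ℚ.* (b ℚ.- d) ℚ.+ (a ℚ.- c) ℚ.* d
  *-regroup = solve 4 (λ a b c d →
    a :* b :+ :- (c :* d) := a :* (b :+ :- d) :+ (a :+ :- c) :* d) refl

  reciprocal : ∀ S → 0ℚ ℚ.< S → ∃ λ i → 0ℚ ℚ.< i × i ℚ.* S ≡ 1ℚ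
  reciprocal S 0<S = ℚ.1/ S , ℚₚ.positive⁻¹ (ℚ.1/ S) {{ℚₚ.1/pos⇒pos S}} , ℚₚ.*-inverseˡ S
    where
    instance
      S-pos : ℚ.Positive S
      S-pos = ℚ.positive 0<S
      S-nonZero : ℚ.NonZero S
      S-nonZero = ℚₚ.pos⇒nonZero S

  tolerance : ∀ B C ε → 0ℚ ℚ.< B → 0ℚ ℚ.< C → 0ℚ ℚ.< ε →
    ∃ λ δ → 0ℚ ℚ.< δ × B ℚ.* δ ℚ.+ δ ℚ.* C ≡ ε
  tolerance B C ε 0<B 0<C 0<ε
    with i , 0<i , i*S≡1 ← reciprocal (B ℚ.+ C) (ℚₚ.+-mono-< 0<B 0<C) =
    ε ℚ.* i ,
    subst (ℚ._< ε ℚ.* i) (ℚₚ.*-zeroˡ i)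
          (ℚₚ.*-monoˡ-<-pos i {{ℚ.positive 0<i}} 0<ε) ,
    trans (distribute B C ε i)
          (trans (cong (ε ℚ.*_) i*S≡1) (ℚₚ.*-identityʳ ε))

  product-gap : ∀ a b c d B C δ → 0ℚ ℚ.< B → 0ℚ ℚ.< C →
    ℚ.∣ a ∣ ℚ.≤ B → ℚ.∣ d ∣ ℚ.≤ C → ℚ.∣ a ℚ.- c ∣ ℚ.< δ → ℚ.∣ b ℚ.- d ∣ ℚ.< δ →
    ℚ.∣ a ℚ.* b ℚ.- c ℚ.* d ∣ ℚ.< B ℚ.* δ ℚ.+ δ ℚ.* C
  product-gap a b c d B C δ 0<B 0<C ∣a∣≤B ∣d∣≤C ∣a-c∣<δ ∣b-d∣<δ =
    subst (ℚ._< B ℚ.* δ ℚ.+ δ ℚ.* C) (sym (cong ℚ.∣_∣ (*-regroup a b c d)))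
      (ℚₚ.≤-<-trans (ℚₚ.∣p+q∣≤∣p∣+∣q∣ (a ℚ.* (b ℚ.- d)) ((a ℚ.- c) ℚ.* d))
        (ℚₚ.+-mono-< first second))
    where
    first : ℚ.∣ a ℚ.* (b ℚ.- d) ∣ ℚ.< B ℚ.* δ
    first = subst (ℚ._< B ℚ.* δ) (sym (ℚₚ.∣p*q∣≡∣p∣*∣q∣ a (b ℚ.- d)))
      (ℚₚ.≤-<-trans
        (ℚₚ.*-monoʳ-≤-nonNeg ℚ.∣ b ℚ.- d ∣ {{ℚₚ.∣-∣-nonNeg (b ℚ.- d)}} ∣a∣≤B)
        (ℚₚ.*-monoʳ-<-pos B {{ℚ.positive 0<B}} ∣b-d∣<δ))
    second : ℚ.∣ (a ℚ.- c) ℚ.* d ∣ ℚ.< δ ℚ.* C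
    second = subst (ℚ._< δ ℚ.* C) (sym (ℚₚ.∣p*q∣≡∣p∣*∣q∣ (a ℚ.- c) d))
      (ℚₚ.≤-<-trans
        (ℚₚ.*-monoˡ-≤-nonNeg ℚ.∣ a ℚ.- c ∣ {{ℚₚ.∣-∣-nonNeg (a ℚ.- c)}} ∣d∣≤C)
        (ℚₚ.*-monoˡ-<-pos C {{ℚ.positive 0<C}} ∣a-c∣<δ))

  *-cauchy : ∀ {f g} → IsCauchy f → IsCauchy g → IsCauchy (λ n → f n ℚ.* g n)
  *-cauchy {f} {g} cf cg ε 0<ε =
    let B , 0<B , N₁ , hB = eventually-bounded {f} cf
        C , 0<C , N₂ , hC = eventually-bounded {g} cg
        δ , 0<δ , Bδ+δC   = tolerance B C ε 0<B 0<C 0<ε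
        N₃ , hf           = cf δ 0<δ
        N₄ , hg           = cg δ 0<δ
    in (N₁ ℕ.⊔ N₂) ℕ.⊔ (N₃ ℕ.⊔ N₄) , λ m n m≥ n≥ →
      let m≥₁₂ = ℕₚ.m⊔n≤o⇒m≤o (N₁ ℕ.⊔ N₂) (N₃ ℕ.⊔ N₄) m≥
          n≥₁₂ = ℕₚ.m⊔n≤o⇒m≤o (N₁ ℕ.⊔ N₂) (N₃ ℕ.⊔ N₄) n≥
          m≥₃₄ = ℕₚ.m⊔n≤o⇒n≤o (N₁ ℕ.⊔ N₂) (N₃ ℕ.⊔ N₄) m≥
          n≥₃₄ = ℕₚ.m⊔n≤o⇒n≤o (N₁ ℕ.⊔ N₂) (N₃ ℕ.⊔ N₄) n≥
      in subst (ℚ.∣ f m ℚ.* g m ℚ.- f n ℚ.* g n ∣ ℚ.<_) Bδ+δC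
           (product-gap (f m) (g m) (f n) (g n) B C δ 0<B 0<C
             (hB m (ℕₚ.m⊔n≤o⇒m≤o N₁ N₂ m≥₁₂))
             (hC n (ℕₚ.m⊔n≤o⇒n≤o N₁ N₂ n≥₁₂))
             (hf m n (ℕₚ.m⊔n≤o⇒m≤o N₃ N₄ m≥₃₄) (ℕₚ.m⊔n≤o⇒m≤o N₃ N₄ n≥₃₄))
             (hg m n (ℕₚ.m⊔n≤o⇒n≤o N₃ N₄ m≥₃₄) (ℕₚ.m⊔n≤o⇒n≤o N₃ N₄ n≥₃₄)))

infixl 6 _+_
infixl 7 _*_
infix  8 -_
infix  4 _≈_ _<_ _≤_

fromℚ : ℚ → ℝ
fromℚ q = mkℝ (λ _ → q) (const-cauchy q)

fromℕ : ℕ → ℝ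
fromℕ n = fromℚ (+ n ℚ./ 1)

0ℝ 1ℝ : ℝ
0ℝ = fromℚ 0ℚ
1ℝ = fromℚ 1ℚ

_+_ _*_ : ℝ → ℝ → ℝ
x + y = mkℝ (λ n → seq x n ℚ.+ seq y n) (+-cauchy {seq x} {seq y} (cauchy x) (cauchy y))
x * y = mkℝ (λ n → seq x n ℚ.* seq y n) (*-cauchy {seq x} {seq y} (cauchy x) (cauchy y))

-_ : ℝ → ℝ
- x = mkℝ (λ n → ℚ.- seq x n) (neg-cauchy {seq x} (cauchy x))

_≈_ : ℝ → ℝ → Set
x ≈ y = ∀ ε → 0ℚ ℚ.< ε →
  ∃ λ N → ∀ n → N ℕ.≤ n → ℚ.∣ seq x n ℚ.- seq y n ∣ ℚ.< ε

-- Termwise strict inequality would allow equal limits, hence the gap ε.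
_<_ : ℝ → ℝ → Set
x < y = ∃ λ ε → 0ℚ ℚ.< ε ×
  ∃ λ N → ∀ n → N ℕ.≤ n → seq x n ℚ.+ ε ℚ.≤ seq y n

_≤_ : ℝ → ℝ → Set
x ≤ y = ¬ (y < x)

Point : Set
Point = ℝ × ℝ

infix 4 _≈ₚ_

_≈ₚ_ : Point → Point → Set
(x , y) ≈ₚ (x′ , y′) = x ≈ x′ × y ≈ y′

-- The line { (x , y) ∣ a x + b y = d }.
record Line : Set where
  field
    a b d         : ℝ
    nondegenerate : ¬ (a ≈ 0ℝ × b ≈ 0ℝ)

infix 4 _liesOn_

_liesOn_ : Point → Line → Set
(x , y) liesOn l = a * x + b * y ≈ d
  where open Line l

Collinear : Point → Point → Point → Set
Collinear p q r = ∃ λ l → p liesOn l × q liesOn l × r liesOn l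

-- The open triangle pqr: the convex combinations of the vertices in
-- which all three weights are strictly positive.
record InInterior (p q r x : Point) : Set where
  field
    α β γ       : ℝ
    0<α         : 0ℝ < α
    0<β         : 0ℝ < β
    0<γ         : 0ℝ < γ
    sum-to-one  : α + β + γ ≈ 1ℝ
    combination : x ≈ₚ ( α * proj₁ p + β * proj₁ q + γ * proj₁ r
                       , α * proj₂ p + β * proj₂ q + γ * proj₂ r )

-- A set of n points is given by an enumeration without repetition.
record ColoredPointSet (c n : ℕ) : Set where
  field
    point    : Fin n → Point
    distinct : ∀ {i j} → i ≢ j → ¬ (point i ≈ₚ point j)
    color    : Fin n → Fin c

GeneralPosition : ∀ {c n} → ColoredPointSet c n → Set
GeneralPosition P = ∀ {i j k} → i ≢ j → i ≢ k → j ≢ k →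
  ¬ Collinear (point i) (point j) (point k)
  where open ColoredPointSet P

------------------------------------------------------------------------
-- Membership in the interior of a triangle is not decidable for real
-- points, so cardinalities and minima are stated as relations rather
-- than computed.

-- Exactly k elements satisfy Q.
HasSize : {A : Set} → Pred A ℓ → ℕ → Set ℓ
HasSize {A = A} Q k = Σ (List A) λ xs →
  Unique xs × (∀ x → x ∈ xs ⇔ Q x) × length xs ≡ k

IsMinimum : Pred ℕ ℓ → Pred ℕ ℓ
IsMinimum S m = S m × (∀ k → S k → m ℕ.≤ k)

module _ {c n : ℕ} (P : ColoredPointSet c n) where
  open ColoredPointSet P

  AtMostInside : ℕ → Fin n → Fin n → Fin n → Set
  AtMostInside s i j k = ∀ t →
    HasSize (λ l → InInterior (point i) (point j) (point k) (point l)) t →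
    t ℕ.≤ s

  -- Listing the vertices in increasing order counts each triangle once.
  Counted : ℕ → Fin n × Fin n × Fin n → Set
  Counted s (i , j , k) =
    (i Fin.< j × j Fin.< k) ×
    (color i ≡ color j × color j ≡ color k) ×
    AtMostInside s i j k

  -- "X_{≤ s}(P) equals k"
  XOf : ℕ → ℕ → Set
  XOf s k = HasSize (Counted s) k

-- "X_{≤ s}^{(c)}(n) equals m"
X : (c s n : ℕ) → ℕ → Set
X c s n = IsMinimum λ k →
  Σ (ColoredPointSet c n) λ P → GeneralPosition P × XOf P s k

------------------------------------------------------------------------
-- The relational encoding is not vacuous: the sizes used above, and the
-- minimum of any inhabited set of naturals, cannot fail to exist.

private
  ¬¬-allDec : {A : Set} {Q : Pred A ℓ} (xs : List A) → ¬ ¬ All (Dec ∘ Q) xs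
  ¬¬-allDec []       f = f []
  ¬¬-allDec (x ∷ xs) f = ¬¬-allDec xs λ ds →
    f (no (λ q → f (yes q ∷ ds)) ∷ ds)

  ¬¬-size : {A : Set} {Q : Pred A ℓ} (all : List A) → Unique all →
    (∀ x → x ∈ all) → ¬ ¬ ∃ (HasSize Q)
  ¬¬-size {Q = Q} all unique complete f = ¬¬-allDec all λ ds →
    let Q? = λ x → All.lookup ds (complete x) in
    f ( length (filter Q? all) , filter Q? all , Unique.filter⁺ Q? unique
      , (λ x → mk⇔ (proj₂ ∘ ∈-filter⁻ Q? {xs = all}) (∈-filter⁺ Q? (complete x)))
      , refl )

¬¬-insideSize : ∀ {c n} (P : ColoredPointSet c n) (i j k : Fin n) →
  let open ColoredPointSet P in
  ¬ ¬ ∃ (HasSize λ l → InInterior (point i) (point j) (point k) (point l))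
¬¬-insideSize {n = n} P i j k = ¬¬-size (allFin n) (Unique.allFin⁺ n) ∈-allFin

¬¬-XOf : ∀ {c n} (P : ColoredPointSet c n) s → ¬ ¬ ∃ (XOf P s)
¬¬-XOf {n = n} P s = ¬¬-size
  (cartesianProduct (allFin n) (cartesianProduct (allFin n) (allFin n)))
  (Unique.cartesianProduct⁺ u (Unique.cartesianProduct⁺ u u))
  (λ (i , j , k) → ∈-cartesianProduct⁺ (∈-allFin i)
                     (∈-cartesianProduct⁺ (∈-allFin j) (∈-allFin k)))
  where
  u : Unique (allFin n)
  u = Unique.allFin⁺ n

¬¬-minimum : {S : Pred ℕ ℓ} → ∃ S → ¬ ¬ ∃ (IsMinimum S)
¬¬-minimum {S = S} (k , sk) f = none (suc k) k ℕₚ.≤-refl sk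
  where
  none : ∀ b j → j ℕ.< b → ¬ S j
  none (suc b) j j<1+b sj = f (j , sj , λ i si →
    ℕₚ.≮⇒≥ λ i<j → none b i (ℕₚ.<-≤-trans i<j (ℕₚ.≤-pred j<1+b)) si)

{-# OPTIONS --safe #-}

-- Let C be a color class with c |C| ≥ n and fix a pivot p ∈ C.  A line through
-- p and one further point of C splits the rest of C into two open half planes.
-- Sorting each half by angle around p, consecutive points x, y span with p at
-- least |C| − 4 triangles that lie in disjoint cones with apex p and contain no
-- point of C.  The remaining n − |C| ≤ (c − 1) |C| points are spread over these
-- cones, so at least (|C| − 4c) / c of them contain at most c − 1 points.  Summing
-- over p ∈ C counts every triangle at most six times as an ordered triple, which
-- gives n² ≤ 12 c³ k once n ≥ 8 c², where k is the number of triangles sought.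
--
-- Only the orientations of triples matter here.  The claimed inequality is a
-- negation, so one may choose classically an index N at which the rational
-- N-th approximations of the points have the same orientations as the points
-- themselves; the counting takes place among these rational points.

module Submission where

open import Defs
open import Data.Nat as ℕ using (ℕ; zero; suc; _∸_; z≤n; s≤s)
import Data.Nat.Properties as ℕₚ
open import Data.Nat.Tactic.RingSolver using (solve-∀)
open import Data.Integer as ℤ using (+_)
import Data.Integer.Properties as ℤₚ
open import Data.Rational as ℚ using (ℚ; 0ℚ; 1ℚ; ½)
import Data.Rational.Properties as ℚₚ
import Data.Rational.Unnormalised as ℚᵘ
import Data.Rational.Unnormalised.Properties as ℚᵘₚ
open import Data.Rational.Solver using (module +-*-Solver)
open import Data.Fin as Fin using (Fin; zero; suc)
import Data.Fin.Properties as Finₚ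
open import Data.List using (List; []; _∷_; _++_; length; filter; map; concatMap; allFin)
open import Data.List.Properties using (length-++; length-tabulate; length-map)
open import Data.List.Membership.Propositional using (_∈_)
open import Data.List.Membership.Propositional.Properties
open import Data.List.Relation.Unary.Any using (here; there)
open import Data.List.Relation.Unary.All as All using (All; []; _∷_)
import Data.List.Relation.Unary.All.Properties as Allₚ
open import Data.List.Relation.Unary.AllPairs as AllPairs using (AllPairs; []; _∷_)
import Data.List.Relation.Unary.AllPairs.Properties as AllPairsₚ
open import Data.List.Relation.Unary.Unique.Propositional using (Unique)
import Data.List.Relation.Unary.Unique.Propositional.Properties as Unique
open import Data.List.Relation.Binary.Disjoint.Propositional using (Disjoint)
open import Data.List.Relation.Binary.Subset.Propositional using (_⊆_)
open import Data.List.Relation.Binary.Permutation.Propositional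
  using (_↭_; ↭-refl; ↭-prep; ↭-swap; ↭-trans; ↭-sym)
open import Data.List.Relation.Binary.Permutation.Propositional.Properties
  using (shift; ↭-length; All-resp-↭; ∈-resp-↭)
open import Data.Product using (Σ; ∃; _×_; _,_; proj₁; proj₂)
open import Data.Sum as Sum using (_⊎_; inj₁; inj₂)
open import Data.Empty using (⊥-elim)
open import Effect.Monad using (RawMonad)
open import Function using (_∘_; id)
open import Function.Bundles using (mk⇔; Equivalence)
open import Level using (0ℓ)
open import Relation.Binary using (Rel; tri<; tri≈; tri>)
open import Relation.Binary.PropositionalEquality
open import Relation.Nullary using (¬_; yes; no; ¬?; contradiction)
open import Relation.Nullary.Decidable using (_×-dec_; ¬¬-excluded-middle)
open import Relation.Nullary.Negation using (¬¬-Monad)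
open import Relation.Unary using (Pred; Decidable)

private
  variable
    A B : Set

-- Counting in lists

-- Induction on `xs`: one occurrence of the head is deleted from `ys`, and uniqueness keeps the tail
-- inside what remains. The comparisons of finite sets below rest on this.
⊆⇒length≤ : {xs ys : List A} → Unique xs → xs ⊆ ys → length xs ℕ.≤ length ys
⊆⇒length≤ [] _ = z≤n
⊆⇒length≤ {xs = x ∷ xs} {ys} (x∉xs ∷ uxs) sub
  with us , vs , refl ← ∈-∃++ (sub (here refl)) =
  subst (suc (length xs) ℕ.≤_) (sym (↭-length (shift x us vs)))
    (s≤s (⊆⇒length≤ uxs λ z∈xs → drop-head z∈xs (∈-resp-↭ (shift x us vs) (sub (there z∈xs)))))
  where
  drop-head : ∀ {z} → z ∈ xs → z ∈ x ∷ us ++ vs → z ∈ us ++ vs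
  drop-head z∈xs (here refl) = contradiction refl (All.lookup x∉xs z∈xs)
  drop-head z∈xs (there z∈)  = z∈

AllPairs-mapWith∈ : {R S : Rel A 0ℓ} {xs : List A} →
  (∀ {x y} → x ∈ xs → y ∈ xs → R x y → S x y) → AllPairs R xs → AllPairs S xs
AllPairs-mapWith∈ f []         = []
AllPairs-mapWith∈ f (rx ∷ rxs) =
  All.tabulate (λ y∈ → f (here refl) (there y∈) (All.lookup rx y∈)) ∷
  AllPairs-mapWith∈ (λ x∈ y∈ → f (there x∈) (there y∈)) rxs

concatMap-unique : (f : A → List B) {xs : List A} → (∀ x → Unique (f x)) →
  AllPairs (λ x y → Disjoint (f x) (f y)) xs → Unique (concatMap f xs)
concatMap-unique f {xs} u d =
  Unique.concat⁺ (Allₚ.map⁺ (All.universal u xs)) (AllPairsₚ.map⁺ d)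

∈-concatMap : (f : A → List B) {xs : List A} {x : A} {y : B} →
  x ∈ xs → y ∈ f x → y ∈ concatMap f xs
∈-concatMap f x∈ y∈ = ∈-concat⁺′ y∈ (∈-map⁺ f x∈)

∈-concatMap⁻′ : (f : A → List B) {xs : List A} {y : B} →
  y ∈ concatMap f xs → ∃ λ x → x ∈ xs × y ∈ f x
∈-concatMap⁻′ f {xs} y∈ with ys , y∈ys , ys∈ ← ∈-concat⁻′ (map f xs) y∈
  with x , x∈ , refl ← ∈-map⁻ f ys∈ = x , x∈ , y∈ys

-- An averaging bound: an `x` that fails the test has at least `suc s` elements in `f x` and so pays
-- for itself in the last summand. In the application `f` lists the points of a cone.
length-filter-small : (s : ℕ) (f : A → List B) (small? : Decidable (λ x → length (f x) ℕ.≤ s)) →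
  ∀ xs → suc s ℕ.* length xs ℕ.≤
         suc s ℕ.* length (filter small? xs) ℕ.+ length (concatMap f xs)
length-filter-small s f small? [] = ℕₚ.m≤m+n _ _
length-filter-small s f small? (x ∷ xs)
  rewrite length-++ (f x) {concatMap f xs}
  with ih ← length-filter-small s f small? xs | small? x
... | yes _ = ℕₚ.≤-trans
  (ℕₚ.≤-reflexive (ℕₚ.*-suc (suc s) (length xs)))
  (ℕₚ.≤-trans (ℕₚ.+-mono-≤ (ℕₚ.m≤m+n (suc s) (length (f x))) ih)
    (ℕₚ.≤-reflexive (regroup s (length (f x)) (length (filter small? xs)) (length (concatMap f xs)))))
  where
  regroup : ∀ s e b d →
    suc s ℕ.+ e ℕ.+ (suc s ℕ.* b ℕ.+ d) ≡ suc s ℕ.* suc b ℕ.+ (e ℕ.+ d)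
  regroup = solve-∀
... | no e≰s = ℕₚ.≤-trans
  (ℕₚ.≤-reflexive (ℕₚ.*-suc (suc s) (length xs)))
  (ℕₚ.≤-trans (ℕₚ.+-mono-≤ (ℕₚ.≰⇒> e≰s) ih)
    (ℕₚ.≤-reflexive (regroup s (length (f x)) (length (filter small? xs)) (length (concatMap f xs)))))
  where
  regroup : ∀ s e b d → e ℕ.+ (suc s ℕ.* b ℕ.+ d) ≡ suc s ℕ.* b ℕ.+ (e ℕ.+ d)
  regroup = solve-∀

length-concatMap-≥ : (f : A → List B) (xs : List A) {c m d : ℕ} →
  (∀ {x} → x ∈ xs → m ℕ.≤ c ℕ.* length (f x) ℕ.+ d) →
  length xs ℕ.* m ℕ.≤ c ℕ.* length (concatMap f xs) ℕ.+ length xs ℕ.* d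
length-concatMap-≥ f [] _ = z≤n
length-concatMap-≥ f (x ∷ xs) {c} {m} {d} h
  rewrite length-++ (f x) {concatMap f xs} =
  ℕₚ.≤-trans (ℕₚ.+-mono-≤ (h (here refl)) (length-concatMap-≥ f xs {c} (h ∘ there)))
    (ℕₚ.≤-reflexive (regroup c (length (f x)) (length (concatMap f xs)) d (length xs ℕ.* d)))
  where
  regroup : ∀ c e k d r → c ℕ.* e ℕ.+ d ℕ.+ (c ℕ.* k ℕ.+ r) ≡ c ℕ.* (e ℕ.+ k) ℕ.+ (d ℕ.+ r)
  regroup = solve-∀

-- Each strict hypothesis leaves one unit to spare, and these units make up the second summand on
-- the left. They provide the strictness in `large-class`.
length-concatMap-< : (f : A → List B) (xs : List A) {c n : ℕ} →
  (∀ {x} → x ∈ xs → c ℕ.* length (f x) ℕ.< n) →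
  c ℕ.* length (concatMap f xs) ℕ.+ length xs ℕ.≤ length xs ℕ.* n
length-concatMap-< f [] {c} _ = ℕₚ.≤-reflexive (trans (ℕₚ.+-identityʳ (c ℕ.* 0)) (ℕₚ.*-zeroʳ c))
length-concatMap-< f (x ∷ xs) {c} {n} h
  rewrite length-++ (f x) {concatMap f xs} =
  ℕₚ.≤-trans (ℕₚ.≤-reflexive (regroup c (length (f x)) (length (concatMap f xs)) (length xs)))
    (ℕₚ.+-mono-≤ (h (here refl)) (length-concatMap-< f xs {c} (h ∘ there)))
  where
  regroup : ∀ c e k l → c ℕ.* (e ℕ.+ k) ℕ.+ suc l ≡ suc (c ℕ.* e) ℕ.+ (c ℕ.* k ℕ.+ l)
  regroup = solve-∀

colorClass : ∀ {c n} → (Fin n → Fin c) → Fin c → List (Fin n)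
colorClass {n = n} color i = filter (λ x → color x Fin.≟ i) (allFin n)

-- Pigeonhole over `suc c` colors: if every class fell short, summing over the classes, which cover
-- all `n` points, would give `suc c * n < suc c * n`.
large-class : ∀ {c n} (color : Fin n → Fin (suc c)) →
  ∃ λ i → n ℕ.≤ suc c ℕ.* length (colorClass color i)
large-class {c} {n} color with Finₚ.any? (λ i → n ℕ.≤? suc c ℕ.* length (colorClass color i))
... | yes found = found
... | no none = ⊥-elim (ℕₚ.<-irrefl refl (begin-strict
    suc c ℕ.* n                                           ≤⟨ ℕₚ.*-monoʳ-≤ (suc c) covered ⟩
    suc c ℕ.* length (concatMap class colors)             <⟨ ℕₚ.m<m+n _ (s≤s z≤n) ⟩
    suc c ℕ.* length (concatMap class colors) ℕ.+ suc c
      ≡⟨ cong (suc c ℕ.* length (concatMap class colors) ℕ.+_) (sym #colors) ⟩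
    suc c ℕ.* length (concatMap class colors) ℕ.+ length colors
      ≤⟨ length-concatMap-< class colors {suc c} (λ {i} _ → ℕₚ.≰⇒> (λ le → none (i , le))) ⟩
    length colors ℕ.* n                                   ≡⟨ cong (ℕ._* n) #colors ⟩
    suc c ℕ.* n                                           ∎))
  where
  open ℕₚ.≤-Reasoning
  class : Fin (suc c) → List (Fin n)
  class = colorClass color
  colors : List (Fin (suc c))
  colors = allFin (suc c)
  #colors : length colors ≡ suc c
  #colors = length-tabulate id
  covered : n ℕ.≤ length (concatMap class colors)
  covered = subst (ℕ._≤ length (concatMap class colors)) (length-tabulate id)
    (⊆⇒length≤ (Unique.allFin⁺ n) λ {x} x∈ →
      ∈-concatMap class (∈-allFin (color x)) (∈-filter⁺ (λ y → color y Fin.≟ color x) x∈ refl))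

-- Consecutive pairs in a sorted list

module _ {A : Set} {_≺_ : Rel A 0ℓ} (≺-trans : ∀ {x y z} → x ≺ y → y ≺ z → x ≺ z) where

  private
    insertion : ∀ {x ys} → AllPairs _≺_ ys → All (λ y → x ≺ y ⊎ y ≺ x) ys →
      ∃ λ zs → AllPairs _≺_ zs × (x ∷ ys) ↭ zs
    insertion {x} [] [] = x ∷ [] , [] ∷ [] , ↭-refl
    insertion {x} {y ∷ ys} (y≺ ∷ s) (inj₁ x≺y ∷ _) =
      x ∷ y ∷ ys , (x≺y ∷ All.map (≺-trans x≺y) y≺) ∷ y≺ ∷ s , ↭-refl
    insertion {x} {y ∷ ys} (y≺ ∷ s) (inj₂ y≺x ∷ cs) with zs , szs , p ← insertion s cs =
      y ∷ zs , All-resp-↭ p (y≺x ∷ y≺) ∷ szs ,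
      ↭-trans (↭-swap x y ↭-refl) (↭-prep y p)

  -- Insertion sort driven by evidence: comparability is asked only for pairs of the list, because
  -- directions around a pivot are linearly ordered only within a half plane.
  sorting : ∀ {xs} → AllPairs (λ x y → x ≺ y ⊎ y ≺ x) xs →
    ∃ λ ys → AllPairs _≺_ ys × xs ↭ ys
  sorting [] = [] , [] , ↭-refl
  sorting {x ∷ _} (c ∷ cs) with ys , sys , p ← sorting cs
    with zs , szs , q ← insertion sys (All-resp-↭ p c) =
    zs , szs , ↭-trans (↭-prep x p) q

consecutive : List A → List (A × A)
consecutive []           = []
consecutive (x ∷ [])     = []
consecutive (x ∷ y ∷ xs) = (x , y) ∷ consecutive (y ∷ xs)

length-consecutive : (xs : List A) → length xs ℕ.≤ suc (length (consecutive xs))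
length-consecutive []           = z≤n
length-consecutive (x ∷ [])     = ℕₚ.≤-refl
length-consecutive (x ∷ y ∷ xs) = s≤s (length-consecutive (y ∷ xs))

module _ {A : Set} {_≺_ : Rel A 0ℓ}
  (≺-trans : ∀ {x y z} → x ≺ y → y ≺ z → x ≺ z)
  (≺-asym : ∀ {x y} → x ≺ y → ¬ (y ≺ x)) where

  private
    ≺-irrefl : ∀ {x} → ¬ (x ≺ x)
    ≺-irrefl x≺x = ≺-asym x≺x x≺x

  Between : A × A → A → Set
  Between (x , y) z = x ≺ z × z ≺ y

  consecutive-sound : ∀ {xs} → AllPairs _≺_ xs →
    All (λ (x , y) → x ∈ xs × y ∈ xs × x ≺ y) (consecutive xs)
  consecutive-sound []                    = []
  consecutive-sound ([] ∷ [])             = []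
  consecutive-sound ((x≺y ∷ _) ∷ ys@(_ ∷ _)) =
    (here refl , there (here refl) , x≺y) ∷
    All.map (λ (x∈ , y∈ , lt) → there x∈ , there y∈ , lt) (consecutive-sound ys)

  -- The head lies at or below the start of every pair. Any other `z` is at or above `y`, which
  -- rules out the first pair, and induction rules out the rest.
  consecutive-empty : ∀ {xs} → AllPairs _≺_ xs → ∀ {z} → z ∈ xs →
    All (λ t → ¬ Between t z) (consecutive xs)
  consecutive-empty ([] ∷ [])                  z∈ = []
  consecutive-empty ((x≺y ∷ x≺ys) ∷ ys@(y≺ ∷ _)) (here refl) =
    (λ (x≺x , _) → ≺-irrefl x≺x) ∷
    All.map (λ (q∈ , _) (q≺x , _) → ≺-asym q≺x (All.lookup (x≺y ∷ x≺ys) q∈))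
      (consecutive-sound ys)
  consecutive-empty (_ ∷ ys@(y≺ ∷ _)) (there z∈) =
    (λ (_ , z≺y) → beyond z∈ z≺y) ∷ consecutive-empty ys z∈
    where
    beyond : ∀ {z} → z ∈ _ → ¬ (z ≺ _)
    beyond (here refl) z≺y = ≺-irrefl z≺y
    beyond (there z∈)  z≺y = ≺-asym z≺y (All.lookup y≺ z∈)

  -- Every later pair starts at `y` or above, so what lies between its ends is above `y`, whereas
  -- what lies between `x` and `y` is below `y`.
  consecutive-disjoint : ∀ {xs} → AllPairs _≺_ xs →
    AllPairs (λ t u → t ≢ u × (∀ z → Between t z → ¬ Between u z)) (consecutive xs)
  consecutive-disjoint []                 = []
  consecutive-disjoint ([] ∷ [])          = []
  consecutive-disjoint {x ∷ y ∷ _} ((x≺y ∷ x≺ys) ∷ ys@(y≺ ∷ _)) =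
    All.map later (consecutive-sound ys) ∷ consecutive-disjoint ys
    where
    y≼ : ∀ {q z} → q ∈ y ∷ _ → q ≺ z → y ≺ z
    y≼ (here refl) q≺z = q≺z
    y≼ (there q∈)  q≺z = ≺-trans (All.lookup y≺ q∈) q≺z
    later : ∀ {u} → proj₁ u ∈ _ × proj₂ u ∈ _ × proj₁ u ≺ proj₂ u →
      (x , y) ≢ u × (∀ z → Between (x , y) z → ¬ Between u z)
    later (q∈ , _) =
      (λ { refl → ≺-irrefl (All.lookup (x≺y ∷ x≺ys) q∈) }) ,
      λ z (_ , z≺y) (q≺z , _) → ≺-asym z≺y (y≼ q∈ q≺z)

-- Cones around a pivot

private
  module Identities where
    open +-*-Solver

    antisym : ∀ a b c d → a ℚ.* d ℚ.- b ℚ.* c ≡ ℚ.- (c ℚ.* b ℚ.- d ℚ.* a)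
    antisym = solve 4 (λ a b c d → a :* d :- b :* c := :- (c :* b :- d :* a)) refl

    plücker : ∀ a b c d e f g h →
      (a ℚ.* f ℚ.- b ℚ.* e) ℚ.* (c ℚ.* h ℚ.- d ℚ.* g) ≡
      (a ℚ.* d ℚ.- b ℚ.* c) ℚ.* (e ℚ.* h ℚ.- f ℚ.* g) ℚ.+
      (a ℚ.* h ℚ.- b ℚ.* g) ℚ.* (c ℚ.* f ℚ.- d ℚ.* e)
    plücker = solve 8 (λ a b c d e f g h →
      (a :* f :- b :* e) :* (c :* h :- d :* g) :=
      (a :* d :- b :* c) :* (e :* h :- f :* g) :+
      (a :* h :- b :* g) :* (c :* f :- d :* e)) refl

    negate : ∀ a b c d → ℚ.- (a ℚ.* b ℚ.+ c ℚ.* d) ≡ (ℚ.- a) ℚ.* b ℚ.+ (ℚ.- c) ℚ.* d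
    negate = solve 4 (λ a b c d → :- (a :* b :+ c :* d) := (:- a) :* b :+ (:- c) :* d) refl

infixl 7 _⨯_

abstract

  -- The determinant of two plane vectors, positive when the second lies counterclockwise of the
  -- first within a half turn. Being abstract, it is handled through the laws below instead of
  -- unfolding into coordinates.
  _⨯_ : ℚ × ℚ → ℚ × ℚ → ℚ
  (a , b) ⨯ (c , d) = a ℚ.* d ℚ.- b ℚ.* c

  ⨯-def : ∀ a b c d → (a , b) ⨯ (c , d) ≡ a ℚ.* d ℚ.- b ℚ.* c
  ⨯-def a b c d = refl

  ⨯-zeroʳ : ∀ u → u ⨯ (0ℚ , 0ℚ) ≡ 0ℚ
  ⨯-zeroʳ (a , b) rewrite ℚₚ.*-zeroʳ a | ℚₚ.*-zeroʳ b = refl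

  ⨯-antisym : ∀ u w → u ⨯ w ≡ ℚ.- (w ⨯ u)
  ⨯-antisym (a , b) (c , d) = Identities.antisym a b c d

  -- The three-term Grassmann-Plücker relation. For `u`, `v`, `w` on one side of the line along `o`,
  -- it makes comparison by angle transitive.
  plücker : ∀ o u v w → (o ⨯ v) ℚ.* (u ⨯ w) ≡ (o ⨯ u) ℚ.* (v ⨯ w) ℚ.+ (o ⨯ w) ℚ.* (u ⨯ v)
  plücker (a , b) (c , d) (e , f) (g , h) = Identities.plücker a b c d e f g h

-- The other half plane: every factor involving o changes sign.
plücker′ : ∀ o u v w → (v ⨯ o) ℚ.* (u ⨯ w) ≡ (u ⨯ o) ℚ.* (v ⨯ w) ℚ.+ (w ⨯ o) ℚ.* (u ⨯ v)
plücker′ o u v w rewrite ⨯-antisym v o | ⨯-antisym u o | ⨯-antisym w o =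
  trans (sym (ℚₚ.neg-distribˡ-* (o ⨯ v) (u ⨯ w)))
    (trans (cong ℚ.-_ (plücker o u v w))
      (Identities.negate (o ⨯ u) (v ⨯ w) (o ⨯ w) (u ⨯ v)))

0<-* : ∀ {p q} → 0ℚ ℚ.< p → 0ℚ ℚ.< q → 0ℚ ℚ.< p ℚ.* q
0<-* {p} {q} 0<p 0<q = ℚₚ.positive⁻¹ (p ℚ.* q) {{ℚₚ.pos*pos⇒pos p {{ℚ.positive 0<p}} q {{ℚ.positive 0<q}}}}

0<-*-cancelˡ : ∀ {p q} → 0ℚ ℚ.< p → 0ℚ ℚ.< p ℚ.* q → 0ℚ ℚ.< q
0<-*-cancelˡ {p} {q} 0<p 0<pq =
  ℚₚ.*-cancelˡ-<-nonNeg p {{ℚₚ.pos⇒nonNeg p {{ℚ.positive 0<p}}}}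
    (subst (ℚ._< p ℚ.* q) (sym (ℚₚ.*-zeroʳ p)) 0<pq)

0<p⇒0≮-p : ∀ {p} → 0ℚ ℚ.< p → ¬ (0ℚ ℚ.< ℚ.- p)
0<p⇒0≮-p {p} 0<p 0<-p =
  ℚₚ.<-irrefl refl (subst (0ℚ ℚ.<_) (ℚₚ.+-inverseʳ p) (ℚₚ.+-mono-< 0<p 0<-p))

module Pivot {A : Set} (v : A → ℚ × ℚ) where

  Left : Rel A 0ℓ
  Left x y = 0ℚ ℚ.< v x ⨯ v y

  Left-asym : ∀ {x y} → Left x y → ¬ Left y x
  Left-asym {x} {y} l r = 0<p⇒0≮-p l (subst (0ℚ ℚ.<_) (⨯-antisym (v y) (v x)) r)

  Left-irrefl : ∀ {x} → ¬ Left x x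
  Left-irrefl l = Left-asym l l

  -- When `Left x y` holds, this is the open convex cone spanned by `v x` and `v y`. It contains the
  -- interior of the triangle with the pivot, and it is described by orientations at the pivot
  -- alone.
  Cone : A × A → Pred A 0ℓ
  Cone (x , y) z = Left x z × Left z y

  Cone? : ∀ t → Decidable (Cone t)
  Cone? (x , y) z = (0ℚ ℚ.<? v x ⨯ v z) ×-dec (0ℚ ℚ.<? v z ⨯ v y)

  Apart : Rel (A × A) 0ℓ
  Apart t u = t ≢ u × (∀ z → Cone t z → ¬ Cone u z)

  -- Here h is o ⨯ _ or _ ⨯ o: directions on one side of the line through o are linearly ordered.
  module HalfPlane (h : A → ℚ)
    (relation : ∀ x y z →
      h y ℚ.* (v x ⨯ v z) ≡ h x ℚ.* (v y ⨯ v z) ℚ.+ h z ℚ.* (v x ⨯ v y)) where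

    _≺_ : Rel A 0ℓ
    x ≺ y = 0ℚ ℚ.< h x × 0ℚ ℚ.< h y × Left x y

    private
      -- Both summands on the right of `relation` are products of positive factors.
      product-positive : ∀ {x y z} → 0ℚ ℚ.< h x → 0ℚ ℚ.< h z → Left x y → Left y z →
        0ℚ ℚ.< h y ℚ.* (v x ⨯ v z)
      product-positive {x} {y} {z} hx hz xy yz =
        subst (0ℚ ℚ.<_) (sym (relation x y z)) (ℚₚ.+-mono-< (0<-* hx yz) (0<-* hz xy))

    ≺-trans : ∀ {x y z} → x ≺ y → y ≺ z → x ≺ z
    ≺-trans (hx , hy , xy) (_ , hz , yz) =
      hx , hz , 0<-*-cancelˡ hy (product-positive hx hz xy yz)

    ≺-asym : ∀ {x y} → x ≺ y → ¬ (y ≺ x)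
    ≺-asym (_ , _ , xy) (_ , _ , yx) = Left-asym xy yx

    -- The middle direction is now `z`, and the factor cancelled is `v x ⨯ v y`. Cones over
    -- `≺`-pairs thereby coincide with order intervals, so facts about consecutive pairs become
    -- facts about cones.
    cone⊆half : ∀ {x y z} → x ≺ y → Cone (x , y) z → 0ℚ ℚ.< h z
    cone⊆half {x} {y} {z} (hx , hy , xy) (xz , zy) =
      0<-*-cancelˡ xy (subst (0ℚ ℚ.<_) (ℚₚ.*-comm (h z) (v x ⨯ v y)) (product-positive hx hy xz zy))

    record HalfFan (xs : List A) : Set where
      field
        triangles : List (A × A)
        size      : length xs ℕ.≤ suc (length triangles)
        sound     : All (λ (x , y) → x ∈ xs × y ∈ xs × Left x y) triangles
        apart     : AllPairs Apart triangles
        in-half   : All (λ t → ∀ z → Cone t z → 0ℚ ℚ.< h z) triangles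
        empty     : ∀ {z} → z ∈ xs → All (λ t → ¬ Cone t z) triangles

    -- The triangles are the consecutive pairs of the directions sorted by angle.
    halfFan : ∀ {xs} → Unique xs → All (λ x → 0ℚ ℚ.< h x) xs →
      (∀ {x y} → x ∈ xs → y ∈ xs → x ≢ y → Left x y ⊎ Left y x) → HalfFan xs
    halfFan {xs} unique half total
      with ys , sorted , p ← sorting {_≺_ = _≺_} ≺-trans
             (AllPairs-mapWith∈ (λ x∈ y∈ x≢y →
               let hx = All.lookup half x∈
                   hy = All.lookup half y∈
               in Sum.map (λ l → hx , hy , l) (λ l → hy , hx , l) (total x∈ y∈ x≢y)) unique) =
      record
        { triangles = consecutive ys
        ; size      = subst (ℕ._≤ _) (sym (↭-length p)) (length-consecutive ys)
        ; sound     = All.map (λ (x∈ , y∈ , _ , _ , l) →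
                        ∈-resp-↭ (↭-sym p) x∈ , ∈-resp-↭ (↭-sym p) y∈ , l) pairs
        ; apart     = AllPairs-mapWith∈ (λ t∈ u∈ (t≢u , disjoint) →
                        t≢u , λ z ct cu → disjoint z (between t∈ ct) (between u∈ cu))
                        (consecutive-disjoint ≺-trans ≺-asym sorted)
        ; in-half   = All.map (λ (_ , _ , x≺y) _ → cone⊆half x≺y) pairs
        ; empty     = λ z∈ → All.tabulate λ t∈ c →
                        All.lookup (consecutive-empty ≺-trans ≺-asym sorted (∈-resp-↭ p z∈)) t∈ (between t∈ c)
        }
      where
      pairs : All (λ (x , y) → x ∈ ys × y ∈ ys × x ≺ y) (consecutive ys)
      pairs = consecutive-sound ≺-trans ≺-asym sorted
      between : ∀ {t z} → t ∈ consecutive ys → Cone t z → Between ≺-trans ≺-asym t z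
      between t∈ c@(xz , zy) with _ , _ , x≺y@(hx , hy , _) ← All.lookup pairs t∈ =
        (hx , cone⊆half x≺y c , xz) , (cone⊆half x≺y c , hy , zy)

  record Fan (xs : List A) : Set where
    field
      triangles : List (A × A)
      size      : length xs ℕ.≤ 3 ℕ.+ length triangles
      sound     : All (λ (x , y) → x ∈ xs × y ∈ xs × Left x y) triangles
      apart     : AllPairs Apart triangles
      empty     : ∀ {z} → z ∈ xs → All (λ t → ¬ Cone t z) triangles

  -- The head `o` of the list fixes the dividing line through the pivot, and each half gets its own
  -- fan. The `3` in `size` accounts for `o` and for one direction lost in each half.
  fan : ∀ {xs} → Unique xs →
    (∀ {x y} → x ∈ xs → y ∈ xs → x ≢ y → Left x y ⊎ Left y x) → Fan xs
  fan {[]} _ _ = record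
    { triangles = [] ; size = z≤n ; sound = [] ; apart = [] ; empty = λ _ → [] }
  fan {o ∷ xs} (o∉xs ∷ unique) total = record
    { triangles = L.triangles ++ R.triangles
    ; size      = size
    ; sound     = Allₚ.++⁺
        (All.map (λ (x∈ , y∈ , l) → there (lefts⊆ x∈) , there (lefts⊆ y∈) , l) L.sound)
        (All.map (λ (x∈ , y∈ , l) → there (rights⊆ x∈) , there (rights⊆ y∈) , l) R.sound)
    -- Cones from different halves are disjoint because each stays strictly on its own side of the
    -- line.
    ; apart     = AllPairsₚ.++⁺ L.apart R.apart (All.tabulate λ t∈ → All.tabulate λ u∈ →
        (λ { refl → opposite (isLeft (proj₁ (All.lookup L.sound t∈)))
                             (isRight (proj₁ (All.lookup R.sound u∈))) }) ,
        λ z ct cu → opposite (All.lookup L.in-half t∈ z ct) (All.lookup R.in-half u∈ z cu))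
    ; empty     = empty
    }
    where
    left? : Decidable (λ x → Left o x)
    left? x = 0ℚ ℚ.<? v o ⨯ v x
    lefts rights : List A
    lefts  = filter left? xs
    rights = filter (¬? ∘ left?) xs
    lefts⊆ : lefts ⊆ xs
    lefts⊆ x∈ = proj₁ (∈-filter⁻ left? x∈)
    rights⊆ : rights ⊆ xs
    rights⊆ x∈ = proj₁ (∈-filter⁻ (¬? ∘ left?) x∈)
    isLeft : ∀ {x} → x ∈ lefts → Left o x
    isLeft x∈ = proj₂ (∈-filter⁻ left? {xs = xs} x∈)
    isRight : ∀ {x} → x ∈ rights → Left x o
    isRight x∈ with x∈xs , ¬l ← ∈-filter⁻ (¬? ∘ left?) {xs = xs} x∈
      with total (here refl) (there x∈xs) (All.lookup o∉xs x∈xs)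
    ... | inj₁ l = contradiction l ¬l
    ... | inj₂ r = r
    opposite : ∀ {x} → Left o x → ¬ Left x o
    opposite {x} = Left-asym {o} {x}
    module LeftHalf  = HalfPlane (λ x → v o ⨯ v x) (λ x y z → plücker (v o) (v x) (v y) (v z))
    module RightHalf = HalfPlane (λ x → v x ⨯ v o) (λ x y z → plücker′ (v o) (v x) (v y) (v z))
    module L = LeftHalf.HalfFan (LeftHalf.halfFan (Unique.filter⁺ left? unique) (All.tabulate isLeft)
      (λ x∈ y∈ → total (there (lefts⊆ x∈)) (there (lefts⊆ y∈))))
    module R = RightHalf.HalfFan (RightHalf.halfFan (Unique.filter⁺ (¬? ∘ left?) unique) (All.tabulate isRight)
      (λ x∈ y∈ → total (there (rights⊆ x∈)) (there (rights⊆ y∈))))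
    split : xs ⊆ lefts ++ rights
    split {x} x∈ with left? x
    ... | yes l = ∈-++⁺ˡ (∈-filter⁺ left? x∈ l)
    ... | no ¬l = ∈-++⁺ʳ lefts (∈-filter⁺ (¬? ∘ left?) x∈ ¬l)
    size : suc (length xs) ℕ.≤ 3 ℕ.+ length (L.triangles ++ R.triangles)
    size = s≤s (begin
      length xs                              ≤⟨ ⊆⇒length≤ unique split ⟩
      length (lefts ++ rights)               ≡⟨ length-++ lefts ⟩
      length lefts ℕ.+ length rights         ≤⟨ ℕₚ.+-mono-≤ L.size R.size ⟩
      suc (length L.triangles) ℕ.+ suc (length R.triangles)
        ≡⟨ cong suc (ℕₚ.+-suc (length L.triangles) (length R.triangles)) ⟩
      2 ℕ.+ (length L.triangles ℕ.+ length R.triangles)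
        ≡⟨ cong (2 ℕ.+_) (length-++ L.triangles) ⟨
      2 ℕ.+ length (L.triangles ++ R.triangles) ∎)
      where open ℕₚ.≤-Reasoning
    empty : ∀ {z} → z ∈ o ∷ xs → All (λ t → ¬ Cone t z) (L.triangles ++ R.triangles)
    -- `o` lies on the dividing line, while every cone is contained in an open half plane.
    empty (here refl) = Allₚ.++⁺
      (All.map (λ half c → Left-irrefl {o} (half o c)) L.in-half)
      (All.map (λ half c → Left-irrefl {o} (half o c)) R.in-half)
    empty {z} (there z∈) with ∈-++⁻ lefts (split z∈)
    ... | inj₁ z∈l = Allₚ.++⁺ (L.empty z∈l)
      (All.map (λ half c → opposite (isLeft z∈l) (half z c)) R.in-half)
    ... | inj₂ z∈r = Allₚ.++⁺
      (All.map (λ half c → opposite (half z c) (isRight z∈r)) L.in-half) (R.empty z∈r)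

-- Triangles at every pivot of a large color class

infixl 6 _⊖_

_⊖_ : ℚ × ℚ → ℚ × ℚ → ℚ × ℚ
(a , b) ⊖ (c , d) = a ℚ.- c , b ℚ.- d

module Configuration {s n : ℕ} (color : Fin n → Fin (suc s)) (pt : Fin n → ℚ × ℚ) where

  private
    module At (p : Fin n) = Pivot (λ x → pt x ⊖ pt p)
    open At using (Left; Cone; Cone?)

  Turn : Fin n → Fin n → Fin n → Set
  Turn = Left

  inCone : Fin n → Fin n × Fin n → List (Fin n)
  inCone p t = filter (Cone? p t) (allFin n)

  Turn-asym : ∀ {p x y} → Turn p x y → ¬ Turn p y x
  Turn-asym {p} {x} {y} = At.Left-asym p {x} {y}

  ∈-inCone : ∀ p {x y z} → Turn p x z → Turn p z y → z ∈ inCone p (x , y)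
  ∈-inCone p {x} {y} {z} xz zy = ∈-filter⁺ (Cone? p (x , y)) (∈-allFin z) (xz , zy)

  module _ (general : ∀ {p x y} → p ≢ x → p ≢ y → x ≢ y → Turn p x y ⊎ Turn p y x) where

    -- Here `s` is the threshold and also one less than the number of colors. With c = `suc s`,
    -- `many` is the lower bound (|C| - 4c) / c on the number of sides, freed of subtraction and
    -- division.
    record Triangles (i : Fin (suc s)) (p : Fin n) : Set where
      field
        sides   : List (Fin n × Fin n)
        unique  : Unique sides
        sound   : All (λ (x , y) → (p ≢ x × p ≢ y) × (x ∈ colorClass color i × y ∈ colorClass color i) ×
                                   Turn p x y × length (inCone p (x , y)) ℕ.≤ s) sides
        many    : length (colorClass color i) ℕ.≤ suc s ℕ.* length sides ℕ.+ 4 ℕ.* suc s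

    -- The cones of the fan are disjoint and avoid `C`, so together they hold at most |others|
    -- points. With c = `suc s`, averaging gives c |F| ≤ c |good| + |others|; joined with |C| +
    -- |others| ≤ n ≤ c |C| ≤ c (4 + |F|), the term |others| cancels.
    triangles-at : ∀ i → n ℕ.≤ suc s ℕ.* length (colorClass color i) → ∀ p → Triangles i p
    triangles-at i large p = record
      { sides  = good
      ; unique = Unique.filter⁺ few? (AllPairs.map proj₁ F.apart)
      ; sound  = All.tabulate λ t∈ →
          let t∈F , few = ∈-filter⁻ few? {xs = F.triangles} t∈
              x∈ , y∈ , turn = All.lookup F.sound t∈F
          in (p≢ x∈ , p≢ y∈) , (rest⊆ x∈ , rest⊆ y∈) , turn , few
      ; many   = ℕₚ.+-cancelʳ-≤ (length others) _ _ bound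
      }
      where
      C rest others : List (Fin n)
      C      = colorClass color i
      ≢p? : Decidable (λ x → p ≢ x)
      ≢p? x = ¬? (p Fin.≟ x)
      rest   = filter ≢p? C
      other? : Decidable (λ x → color x ≢ i)
      other? x = ¬? (color x Fin.≟ i)
      others = filter other? (allFin n)
      C-unique : Unique C
      C-unique = Unique.filter⁺ (λ x → color x Fin.≟ i) (Unique.allFin⁺ n)
      rest⊆ : rest ⊆ C
      rest⊆ x∈ = proj₁ (∈-filter⁻ ≢p? x∈)
      p≢ : ∀ {x} → x ∈ rest → p ≢ x
      p≢ x∈ = proj₂ (∈-filter⁻ ≢p? {xs = C} x∈)
      module F = Pivot.Fan (At.fan p (Unique.filter⁺ ≢p? C-unique)
                   (λ x∈ y∈ x≢y → general (p≢ x∈) (p≢ y∈) x≢y))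
      few? : Decidable (λ t → length (inCone p t) ℕ.≤ s)
      few? t = length (inCone p t) ℕ.≤? s
      good : List (Fin n × Fin n)
      good = filter few? F.triangles
      -- The direction of the pivot from itself is zero, so the pivot lies in no open cone.
      not-pivot : ∀ x → ¬ Turn p x p
      not-pivot x l = ℚₚ.<-irrefl refl (subst (0ℚ ℚ.<_) eq l)
        where
        eq : (pt x ⊖ pt p) ⨯ (pt p ⊖ pt p) ≡ 0ℚ
        eq = trans (cong ((pt x ⊖ pt p) ⨯_)
               (cong₂ _,_ (ℚₚ.+-inverseʳ (proj₁ (pt p))) (ℚₚ.+-inverseʳ (proj₂ (pt p)))))
               (⨯-zeroʳ (pt x ⊖ pt p))
      C⊆ : C ⊆ p ∷ rest
      C⊆ {x} x∈ with p Fin.≟ x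
      ... | yes refl = here refl
      ... | no p≢x   = there (∈-filter⁺ ≢p? x∈ p≢x)
      cones-unique : Unique (concatMap (inCone p) F.triangles)
      cones-unique = concatMap-unique (inCone p)
        (λ t → Unique.filter⁺ (Cone? p t) (Unique.allFin⁺ n))
        (AllPairs.map (λ {t} {u} (_ , disjoint) {z} (z∈t , z∈u) → disjoint z
          (proj₂ (∈-filter⁻ (Cone? p t) {xs = allFin n} z∈t))
          (proj₂ (∈-filter⁻ (Cone? p u) {xs = allFin n} z∈u))) F.apart)
      cones⊆others : concatMap (inCone p) F.triangles ⊆ others
      cones⊆others {z} z∈ with t , t∈ , z∈t ← ∈-concatMap⁻′ (inCone p) z∈
        with _ , cone ← ∈-filter⁻ (Cone? p t) {xs = allFin n} z∈t =
        ∈-filter⁺ other? (∈-allFin z) λ col →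
          case-C (C⊆ (∈-filter⁺ (λ x → color x Fin.≟ i) (∈-allFin z) col)) cone
        where
        case-C : z ∈ p ∷ rest → ¬ Cone p t z
        case-C (here refl) (l , _) = not-pivot (proj₁ t) l
        case-C (there z∈)  cone    = All.lookup (F.empty z∈) t∈ cone
      class+others : length C ℕ.+ length others ℕ.≤ n
      class+others = subst₂ ℕ._≤_ (length-++ C) (length-tabulate id)
        (⊆⇒length≤ {xs = C ++ others} {ys = allFin n}
          (Unique.++⁺ C-unique (Unique.filter⁺ other? (Unique.allFin⁺ n))
            (λ (z∈C , z∈O) → proj₂ (∈-filter⁻ other? {xs = allFin n} z∈O)
                              (proj₂ (∈-filter⁻ (λ x → color x Fin.≟ i) {xs = allFin n} z∈C))))
          (λ _ → ∈-allFin _))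
      bound : length C ℕ.+ length others ℕ.≤ suc s ℕ.* length good ℕ.+ 4 ℕ.* suc s ℕ.+ length others
      bound = begin
        length C ℕ.+ length others           ≤⟨ class+others ⟩
        n                                    ≤⟨ large ⟩
        -- The `4` is the `3` lost by the fan plus the pivot, which `rest` leaves out.
        suc s ℕ.* length C                   ≤⟨ ℕₚ.*-monoʳ-≤ (suc s)
                                                  (ℕₚ.≤-trans (⊆⇒length≤ C-unique C⊆) (s≤s F.size)) ⟩
        suc s ℕ.* (4 ℕ.+ length F.triangles) ≡⟨ ℕₚ.*-distribˡ-+ (suc s) 4 (length F.triangles) ⟩
        suc s ℕ.* 4 ℕ.+ suc s ℕ.* length F.triangles
          ≤⟨ ℕₚ.+-monoʳ-≤ (suc s ℕ.* 4) (length-filter-small s (inCone p) few? F.triangles) ⟩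
        suc s ℕ.* 4 ℕ.+ (suc s ℕ.* length good ℕ.+ length (concatMap (inCone p) F.triangles))
          ≤⟨ ℕₚ.+-monoʳ-≤ (suc s ℕ.* 4) (ℕₚ.+-monoʳ-≤ (suc s ℕ.* length good)
               (⊆⇒length≤ cones-unique cones⊆others)) ⟩
        suc s ℕ.* 4 ℕ.+ (suc s ℕ.* length good ℕ.+ length others)
          ≡⟨ regroup (suc s) (length good) (length others) ⟩
        suc s ℕ.* length good ℕ.+ 4 ℕ.* suc s ℕ.+ length others ∎
        where
        open ℕₚ.≤-Reasoning
        regroup : ∀ c g o → c ℕ.* 4 ℕ.+ (c ℕ.* g ℕ.+ o) ≡ c ℕ.* g ℕ.+ 4 ℕ.* c ℕ.+ o
        regroup = solve-∀

    AlmostEmpty : Fin n × Fin n × Fin n → Set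
    AlmostEmpty (p , x , y) =
      (p ≢ x × p ≢ y × x ≢ y) × (color p ≡ color x × color x ≡ color y) ×
      Turn p x y × length (inCone p (x , y)) ℕ.≤ s

    -- Put c = `suc s`, m = |C|, and let N be the number of triples. Summing `many` over the m
    -- pivots gives m² ≤ cN + 4cm, and n ≤ cm turns n ≥ 8c² into m ≥ 8c. Hence m² ≤ 2cN and n² ≤
    -- c²m² ≤ 2c³N.
    almostEmpty-triangles : 8 ℕ.* (suc s ℕ.* suc s) ℕ.≤ n →
      ∃ λ ts → Unique ts × All AlmostEmpty ts ×
        n ℕ.* n ℕ.≤ 2 ℕ.* (suc s ℕ.* suc s ℕ.* suc s) ℕ.* length ts
    almostEmpty-triangles n-large with i , large ← large-class color =
      concatMap from C , unique , sound , count
      where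
      C : List (Fin n)
      C = colorClass color i
      colored : ∀ {x} → x ∈ C → color x ≡ i
      colored x∈ = proj₂ (∈-filter⁻ (λ x → color x Fin.≟ i) {xs = allFin n} x∈)
      module T (p : Fin n) = Triangles (triangles-at i large p)
      from : Fin n → List (Fin n × Fin n × Fin n)
      from p = map (p ,_) (T.sides p)
      unique : Unique (concatMap from C)
      unique = concatMap-unique from
        (λ p → Unique.map⁺ (λ { refl → refl }) (T.unique p))
        (AllPairs.map apart (Unique.filter⁺ (λ x → color x Fin.≟ i) (Unique.allFin⁺ n)))
        where
        apart : ∀ {p q} → p ≢ q → Disjoint (from p) (from q)
        apart p≢q (t∈p , t∈q) with _ , _ , refl ← ∈-map⁻ _ t∈p | _ , _ , eq ← ∈-map⁻ _ t∈q =
          p≢q (cong proj₁ eq)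
      sound : All AlmostEmpty (concatMap from C)
      sound = All.tabulate λ t∈ → sound′ (∈-concatMap⁻′ from t∈)
        where
        sound′ : ∀ {t} → ∃ (λ p → p ∈ C × t ∈ from p) → AlmostEmpty t
        sound′ (p , p∈ , t∈) with (x , y) , xy∈ , refl ← ∈-map⁻ (p ,_) t∈
          with (p≢x , p≢y) , (x∈ , y∈) , turn , few ← All.lookup (T.sound p) xy∈ =
          (p≢x , p≢y , λ { refl → At.Left-irrefl p turn }) ,
          (trans (colored p∈) (sym (colored x∈)) , trans (colored x∈) (sym (colored y∈))) ,
          turn , few
      m N c : ℕ
      m = length C
      N = length (concatMap from C)
      c = suc s
      class-large : 8 ℕ.* c ℕ.≤ m
      class-large = ℕₚ.*-cancelˡ-≤ c (ℕₚ.≤-trans (ℕₚ.≤-reflexive (regroup c)) (ℕₚ.≤-trans n-large large))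
        where
        regroup : ∀ c → c ℕ.* (8 ℕ.* c) ≡ 8 ℕ.* (c ℕ.* c)
        regroup = solve-∀
      pairs : m ℕ.* m ℕ.≤ c ℕ.* N ℕ.+ m ℕ.* (4 ℕ.* c)
      pairs = length-concatMap-≥ from C {c} λ {p} _ →
        subst (λ l → m ℕ.≤ c ℕ.* l ℕ.+ 4 ℕ.* c) (sym (length-map (p ,_) (T.sides p))) (T.many p)
      -- Doubling `pairs` makes the error term m · 8c, which one copy of m² absorbs.
      m²-bound : m ℕ.* m ℕ.≤ 2 ℕ.* c ℕ.* N
      m²-bound = ℕₚ.+-cancelʳ-≤ (m ℕ.* m) _ _ (begin
        m ℕ.* m ℕ.+ m ℕ.* m                         ≤⟨ ℕₚ.+-mono-≤ pairs pairs ⟩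
        (c ℕ.* N ℕ.+ m ℕ.* (4 ℕ.* c)) ℕ.+ (c ℕ.* N ℕ.+ m ℕ.* (4 ℕ.* c)) ≡⟨ regroup c N m ⟩
        2 ℕ.* c ℕ.* N ℕ.+ m ℕ.* (8 ℕ.* c)           ≤⟨ ℕₚ.+-monoʳ-≤ (2 ℕ.* c ℕ.* N) (ℕₚ.*-monoʳ-≤ m class-large) ⟩
        2 ℕ.* c ℕ.* N ℕ.+ m ℕ.* m                   ∎)
        where
        open ℕₚ.≤-Reasoning
        regroup : ∀ c N m → (c ℕ.* N ℕ.+ m ℕ.* (4 ℕ.* c)) ℕ.+ (c ℕ.* N ℕ.+ m ℕ.* (4 ℕ.* c)) ≡
          2 ℕ.* c ℕ.* N ℕ.+ m ℕ.* (8 ℕ.* c)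
        regroup = solve-∀
      count : n ℕ.* n ℕ.≤ 2 ℕ.* (c ℕ.* c ℕ.* c) ℕ.* N
      count = begin
        n ℕ.* n                          ≤⟨ ℕₚ.*-mono-≤ large large ⟩
        (c ℕ.* m) ℕ.* (c ℕ.* m)          ≡⟨ square c m ⟩
        (c ℕ.* c) ℕ.* (m ℕ.* m)          ≤⟨ ℕₚ.*-monoʳ-≤ (c ℕ.* c) m²-bound ⟩
        (c ℕ.* c) ℕ.* (2 ℕ.* c ℕ.* N)    ≡⟨ cube c N ⟩
        2 ℕ.* (c ℕ.* c ℕ.* c) ℕ.* N      ∎
        where
        open ℕₚ.≤-Reasoning
        square : ∀ c m → (c ℕ.* m) ℕ.* (c ℕ.* m) ≡ (c ℕ.* c) ℕ.* (m ℕ.* m)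
        square = solve-∀
        cube : ∀ c N → (c ℕ.* c) ℕ.* (2 ℕ.* c ℕ.* N) ≡ 2 ℕ.* (c ℕ.* c ℕ.* c) ℕ.* N
        cube = solve-∀

-- Signs of Cauchy sequences

Eventually : (ℕ → Set) → Set
Eventually P = ∃ λ N → ∀ n → N ℕ.≤ n → P n

eventually-× : ∀ {P Q : ℕ → Set} → Eventually P → Eventually Q → Eventually (λ n → P n × Q n)
eventually-× (M , p) (N , q) = M ℕ.⊔ N , λ n n≥ →
  p n (ℕₚ.m⊔n≤o⇒m≤o M N n≥) , q n (ℕₚ.m⊔n≤o⇒n≤o M N n≥)

eventually-map : ∀ {P Q : ℕ → Set} → (∀ {n} → P n → Q n) → Eventually P → Eventually Q
eventually-map f (N , p) = N , λ n n≥ → f (p n n≥)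

eventually-∀ : ∀ {k} {P : Fin k → ℕ → Set} →
  (∀ i → Eventually (P i)) → Eventually (λ n → ∀ i → P i n)
eventually-∀ {zero}  _ = 0 , λ _ _ ()
eventually-∀ {suc k} e = eventually-map (λ { (p , ps) zero → p ; (p , ps) (suc i) → ps i })
  (eventually-× (e zero) (eventually-∀ (e ∘ suc)))

-- Double-negation shift, which holds constructively over a finite index set.
¬¬-∀ : ∀ {k} {P : Fin k → Set} → (∀ i → ¬ ¬ P i) → ¬ ¬ (∀ i → P i)
¬¬-∀ = Finₚ.sequence (RawMonad.rawApplicative ¬¬-Monad)

-- Stated for bare sequences, so that termwise rational identities can be transported along. `x ≈ y`
-- unfolds to `Null` of the termwise difference.
Null Positive : (ℕ → ℚ) → Set
Null f = ∀ ε → 0ℚ ℚ.< ε → Eventually (λ n → ℚ.∣ f n ∣ ℚ.< ε)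
Positive f = ∃ λ ε → 0ℚ ℚ.< ε × Eventually (λ n → ε ℚ.≤ f n)

null-resp : ∀ {f g} → (∀ n → f n ≡ g n) → Null f → Null g
null-resp f≗g null ε 0<ε =
  eventually-map (λ {n} → subst (λ x → ℚ.∣ x ∣ ℚ.< ε) (f≗g n)) (null ε 0<ε)

positive-resp : ∀ {f g} → (∀ n → f n ≡ g n) → Positive f → Positive g
positive-resp f≗g (ε , 0<ε , e) = ε , 0<ε , eventually-map (λ {n} → subst (ε ℚ.≤_) (f≗g n)) e

null-0 : Null (λ _ → 0ℚ)
null-0 ε 0<ε = 0 , λ _ _ → 0<ε

0<½* : ∀ {ε} → 0ℚ ℚ.< ε → 0ℚ ℚ.< ½ ℚ.* ε
0<½* = 0<-* (ℚₚ.positive⁻¹ ½)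

½+½ : ∀ ε → ½ ℚ.* ε ℚ.+ ½ ℚ.* ε ≡ ε
½+½ ε = trans (sym (ℚₚ.*-distribʳ-+ ε ½ ½)) (ℚₚ.*-identityˡ ε)

p≤∣p∣ : ∀ p → p ℚ.≤ ℚ.∣ p ∣
p≤∣p∣ p with ℚₚ.≤-total 0ℚ p
... | inj₁ 0≤p = ℚₚ.≤-reflexive (sym (ℚₚ.0≤p⇒∣p∣≡p 0≤p))
... | inj₂ p≤0 = ℚₚ.≤-trans p≤0 (ℚₚ.0≤∣p∣ p)

null-+ : ∀ {f g} → Null f → Null g → Null (λ n → f n ℚ.+ g n)
null-+ {f} {g} nf ng ε 0<ε = eventually-map
  (λ {n} (hf , hg) → ℚₚ.≤-<-trans (ℚₚ.∣p+q∣≤∣p∣+∣q∣ (f n) (g n))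
    (subst (ℚ.∣ f n ∣ ℚ.+ ℚ.∣ g n ∣ ℚ.<_) (½+½ ε) (ℚₚ.+-mono-< hf hg)))
  (eventually-× (nf (½ ℚ.* ε) (0<½* 0<ε)) (ng (½ ℚ.* ε) (0<½* 0<ε)))

null-neg : ∀ {f} → Null f → Null (λ n → ℚ.- f n)
null-neg {f} nf ε 0<ε =
  eventually-map (λ {n} → subst (ℚ._< ε) (sym (ℚₚ.∣-p∣≡∣p∣ (f n)))) (nf ε 0<ε)

eventually-bounded : ∀ {f} → IsCauchy f →
  ∃ λ B → 0ℚ ℚ.< B × Eventually (λ n → ℚ.∣ f n ∣ ℚ.≤ B)
eventually-bounded {f} cf with N , h ← cf 1ℚ (ℚₚ.positive⁻¹ 1ℚ) =
  1ℚ ℚ.+ ℚ.∣ f N ∣ , ℚₚ.+-mono-<-≤ (ℚₚ.positive⁻¹ 1ℚ) (ℚₚ.0≤∣p∣ (f N)) ,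
  N , λ n n≥ → begin
    ℚ.∣ f n ∣                        ≡⟨ cong ℚ.∣_∣ (split (f n) (f N)) ⟩
    ℚ.∣ (f n ℚ.- f N) ℚ.+ f N ∣      ≤⟨ ℚₚ.∣p+q∣≤∣p∣+∣q∣ (f n ℚ.- f N) (f N) ⟩
    ℚ.∣ f n ℚ.- f N ∣ ℚ.+ ℚ.∣ f N ∣  ≤⟨ ℚₚ.+-monoˡ-≤ ℚ.∣ f N ∣ (ℚₚ.<⇒≤ (h n N n≥ ℕₚ.≤-refl)) ⟩
    1ℚ ℚ.+ ℚ.∣ f N ∣                 ∎
  where
  open ℚₚ.≤-Reasoning
  open +-*-Solver
  split : ∀ a b → a ≡ (a ℚ.- b) ℚ.+ b
  split = solve 2 (λ a b → a := (a :- b) :+ b) refl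

reciprocal : ∀ B → 0ℚ ℚ.< B → ∃ λ i → 0ℚ ℚ.< i × i ℚ.* B ≡ 1ℚ
reciprocal B 0<B = ℚ.1/ B , ℚₚ.positive⁻¹ (ℚ.1/ B) {{ℚₚ.1/pos⇒pos B}} , ℚₚ.*-inverseˡ B
  where
  instance
    B-pos : ℚ.Positive B
    B-pos = ℚ.positive 0<B
    B-nonZero : ℚ.NonZero B
    B-nonZero = ℚₚ.pos⇒nonZero B

private
  ∣product∣<ε : ∀ {a b ε i B} → 0ℚ ℚ.< B → i ℚ.* B ≡ 1ℚ →
    ℚ.∣ a ∣ ℚ.< ε ℚ.* i → ℚ.∣ b ∣ ℚ.≤ B → ℚ.∣ a ℚ.* b ∣ ℚ.< ε
  ∣product∣<ε {a} {b} {ε} {i} {B} 0<B i*B≡1 small bound =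
    subst (ℚ._< ε) (sym (ℚₚ.∣p*q∣≡∣p∣*∣q∣ a b))
      (ℚₚ.≤-<-trans (ℚₚ.*-monoˡ-≤-nonNeg ℚ.∣ a ∣ {{ℚₚ.∣-∣-nonNeg a}} bound)
        (subst (ℚ.∣ a ∣ ℚ.* B ℚ.<_)
          (trans (ℚₚ.*-assoc ε i B) (trans (cong (ε ℚ.*_) i*B≡1) (ℚₚ.*-identityʳ ε)))
          (ℚₚ.*-monoˡ-<-pos B {{ℚ.positive 0<B}} small)))

-- `g` is eventually bounded by some `B`, so it suffices to make `f` smaller than ε/B.
null-* : ∀ {f g} → Null f → IsCauchy g → Null (λ n → f n ℚ.* g n)
null-* {f} {g} nf cg ε 0<ε =
  let B , 0<B , bounded = eventually-bounded {g} cg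
      i , 0<i , i*B≡1   = reciprocal B 0<B
  in eventually-map
       (λ {n} (small , bound) → ∣product∣<ε {f n} {g n} {ε} {i} {B} 0<B i*B≡1 small bound)
       (eventually-× (nf (ε ℚ.* i) (0<-* 0<ε 0<i)) bounded)

positive⇒eventually : ∀ {f} → Positive f → Eventually (λ n → 0ℚ ℚ.< f n)
positive⇒eventually (ε , 0<ε , e) = eventually-map (ℚₚ.<-≤-trans 0<ε) e

positive-* : ∀ {f g} → Positive f → Positive g → Positive (λ n → f n ℚ.* g n)
positive-* {f} {g} (ε , 0<ε , ef) (δ , 0<δ , eg) = ε ℚ.* δ , 0<-* 0<ε 0<δ ,
  eventually-map (λ {n} (hf , hg) → ℚₚ.≤-trans
    (ℚₚ.*-monoʳ-≤-nonNeg δ {{ℚₚ.pos⇒nonNeg δ {{ℚ.positive 0<δ}}}} hf)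
    (ℚₚ.*-monoˡ-≤-nonNeg (f n)
      {{ℚ.nonNegative (ℚₚ.≤-trans (ℚₚ.<⇒≤ 0<ε) hf)}} hg))
  (eventually-× ef eg)

positive+null : ∀ {f g} → Positive f → Null g → Positive (λ n → f n ℚ.+ g n)
positive+null {f} {g} (ε , 0<ε , ef) ng = ½ ℚ.* ε , 0<½* 0<ε ,
  eventually-map (λ {n} (hf , hg) → begin
    ½ ℚ.* ε                             ≡⟨ regroup (½ ℚ.* ε) ⟩
    (½ ℚ.* ε ℚ.+ ½ ℚ.* ε) ℚ.- ½ ℚ.* ε   ≡⟨ cong (ℚ._- ½ ℚ.* ε) (½+½ ε) ⟩
    ε ℚ.- ½ ℚ.* ε                       ≤⟨ ℚₚ.+-mono-≤ hf (-∣≤ (g n) (ℚₚ.<⇒≤ hg)) ⟩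
    f n ℚ.+ g n                         ∎)
  (eventually-× ef (ng (½ ℚ.* ε) (0<½* 0<ε)))
  where
  open ℚₚ.≤-Reasoning
  open +-*-Solver
  regroup : ∀ a → a ≡ (a ℚ.+ a) ℚ.- a
  regroup = solve 1 (λ a → a := (a :+ a) :- a) refl
  double-neg : ∀ a → ℚ.- (ℚ.- a) ≡ a
  double-neg = solve 1 (λ a → :- (:- a) := a) refl
  -∣≤ : ∀ x {δ} → ℚ.∣ x ∣ ℚ.≤ δ → ℚ.- δ ℚ.≤ x
  -∣≤ x {δ} h = subst (ℚ.- δ ℚ.≤_) (double-neg x) (ℚₚ.neg-antimono-≤
    (ℚₚ.≤-trans (p≤∣p∣ (ℚ.- x)) (subst (ℚ._≤ δ) (sym (ℚₚ.∣-p∣≡∣p∣ x)) h)))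

private
  -- Terms from `N` on differ from the large one by less than ε/2, so they keep at least ε/2.
  large-term⇒positive : ∀ {f N ε} → 0ℚ ℚ.< ε →
    (∀ m n → N ℕ.≤ m → N ℕ.≤ n → ℚ.∣ f m ℚ.- f n ∣ ℚ.< ½ ℚ.* ε) →
    ∀ n → N ℕ.≤ n → ε ℚ.≤ f n → Positive f
  large-term⇒positive {f} {N} {ε} 0<ε h n n≥ ε≤ = ½ ℚ.* ε , 0<½* 0<ε , N , λ m m≥ → begin
    ½ ℚ.* ε                        ≡⟨ regroup (½ ℚ.* ε) ⟩
    (½ ℚ.* ε ℚ.+ ½ ℚ.* ε) ℚ.- ½ ℚ.* ε  ≡⟨ cong (ℚ._- ½ ℚ.* ε) (½+½ ε) ⟩
    ε ℚ.- ½ ℚ.* ε                  ≤⟨ ℚₚ.+-mono-≤ ε≤ (ℚₚ.neg-antimono-≤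
                                        (ℚₚ.≤-trans (p≤∣p∣ (f n ℚ.- f m)) (ℚₚ.<⇒≤ (h n m n≥ m≥)))) ⟩
    f n ℚ.- (f n ℚ.- f m)          ≡⟨ cancel (f n) (f m) ⟩
    f m                            ∎
    where
    open ℚₚ.≤-Reasoning
    open +-*-Solver
    regroup : ∀ a → a ≡ (a ℚ.+ a) ℚ.- a
    regroup = solve 1 (λ a → a := (a :+ a) :- a) refl
    cancel : ∀ a b → a ℚ.- (a ℚ.- b) ≡ b
    cancel = solve 2 (λ a b → a :- (a :- b) := b) refl

-- A constructive substitute for trichotomy. Comparing the rational |f n| with ε is decidable, and a
-- late term of size at least ε would make `f` or its negative positive.
signless⇒null : ∀ {f} → IsCauchy f → ¬ Positive f → ¬ Positive (λ n → ℚ.- f n) → Null f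
signless⇒null {f} cf ¬pos ¬neg ε 0<ε with N , h ← cf (½ ℚ.* ε) (0<½* 0<ε) = N , small
  where
  open +-*-Solver
  negate : ∀ a b → ℚ.- (a ℚ.- b) ≡ ℚ.- a ℚ.- ℚ.- b
  negate = solve 2 (λ a b → :- (a :- b) := :- a :- :- b) refl
  -h : ∀ m n → N ℕ.≤ m → N ℕ.≤ n → ℚ.∣ ℚ.- f m ℚ.- ℚ.- f n ∣ ℚ.< ½ ℚ.* ε
  -h m n m≥ n≥ = subst (ℚ._< ½ ℚ.* ε)
    (trans (sym (ℚₚ.∣-p∣≡∣p∣ (f m ℚ.- f n))) (cong ℚ.∣_∣ (negate (f m) (f n)))) (h m n m≥ n≥)
  small : ∀ n → N ℕ.≤ n → ℚ.∣ f n ∣ ℚ.< ε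
  small n n≥ with ℚ.∣ f n ∣ ℚₚ.<? ε | ℚₚ.∣p∣≡p∨∣p∣≡-p (f n)
  ... | yes lt | _       = lt
  ... | no nlt | inj₁ eq = contradiction
    (large-term⇒positive {f} 0<ε h n n≥ (subst (ε ℚ.≤_) eq (ℚₚ.≮⇒≥ nlt))) ¬pos
  ... | no nlt | inj₂ eq = contradiction
    (large-term⇒positive {λ n → ℚ.- f n} 0<ε -h n n≥ (subst (ε ℚ.≤_) eq (ℚₚ.≮⇒≥ nlt))) ¬neg

-- Orientation of real points

at : Point → ℕ → ℚ × ℚ
at (x , y) n = seq x n , seq y n

turn : Point → Point → Point → ℕ → ℚ
turn p q r n = (at q n ⊖ at p n) ⨯ (at r n ⊖ at p n)

cauchy-resp : ∀ {f g} → (∀ n → f n ≡ g n) → IsCauchy f → IsCauchy g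
cauchy-resp f≗g cf ε 0<ε = let N , h = cf ε 0<ε in
  N , λ m n m≥ n≥ → subst₂ (λ a b → ℚ.∣ a ℚ.- b ∣ ℚ.< ε) (f≗g m) (f≗g n) (h m n m≥ n≥)

turn-def : ∀ p q r n → turn p q r n ≡
  (seq (proj₁ q) n ℚ.- seq (proj₁ p) n) ℚ.* (seq (proj₂ r) n ℚ.- seq (proj₂ p) n) ℚ.-
  (seq (proj₂ q) n ℚ.- seq (proj₂ p) n) ℚ.* (seq (proj₁ r) n ℚ.- seq (proj₁ p) n)
turn-def p q r n = ⨯-def _ _ _ _

turn-swap : ∀ p q r n → turn p q r n ≡ ℚ.- turn p r q n
turn-swap p q r n = ⨯-antisym (at q n ⊖ at p n) (at r n ⊖ at p n)

-- Termwise, the turn is the sequence of a real number built from the coordinates.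
turn-cauchy : ∀ p q r → IsCauchy (turn p q r)
turn-cauchy p q r = cauchy-resp (λ n → sym (turn-def p q r n)) (cauchy
  ((proj₁ q + - proj₁ p) * (proj₂ r + - proj₂ p) + - ((proj₂ q + - proj₂ p) * (proj₁ r + - proj₁ p))))

private
  module Rational where
    open +-*-Solver

    offset : ∀ x p q r α β γ →
      (x ℚ.- (α ℚ.* p ℚ.+ β ℚ.* q ℚ.+ γ ℚ.* r)) ℚ.+ (α ℚ.+ β ℚ.+ γ ℚ.- 1ℚ) ℚ.* p ≡
      (x ℚ.- p) ℚ.- (β ℚ.* (q ℚ.- p) ℚ.+ γ ℚ.* (r ℚ.- p))
    offset = solve 7 (λ x p q r α β γ →
      (x :- (α :* p :+ β :* q :+ γ :* r)) :+ (α :+ β :+ γ :- con 1ℚ) :* p :=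
      (x :- p) :- (β :* (q :- p) :+ γ :* (r :- p))) refl

    -- Read `(a , b)`, `(c , d)`, `(e , f)` as the vectors from p to q, r, x. By bilinearity the
    -- turn of x against q is γ times that of r, up to terms linear in the deviation of `(e , f)`
    -- from the combination with weights β and γ.
    expandʳ : ∀ a b c d e f β γ →
      γ ℚ.* (a ℚ.* d ℚ.- b ℚ.* c) ℚ.+
      ((f ℚ.- (β ℚ.* b ℚ.+ γ ℚ.* d)) ℚ.* a ℚ.+ ℚ.- ((e ℚ.- (β ℚ.* a ℚ.+ γ ℚ.* c)) ℚ.* b)) ≡
      a ℚ.* f ℚ.- b ℚ.* e
    expandʳ = solve 8 (λ a b c d e f β γ →
      γ :* (a :* d :- b :* c) :+
      ((f :- (β :* b :+ γ :* d)) :* a :+ :- ((e :- (β :* a :+ γ :* c)) :* b)) :=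
      a :* f :- b :* e) refl

    expandˡ : ∀ a b c d e f β γ →
      β ℚ.* (a ℚ.* d ℚ.- b ℚ.* c) ℚ.+
      ((e ℚ.- (β ℚ.* a ℚ.+ γ ℚ.* c)) ℚ.* d ℚ.+ ℚ.- ((f ℚ.- (β ℚ.* b ℚ.+ γ ℚ.* d)) ℚ.* c)) ≡
      e ℚ.* d ℚ.- f ℚ.* c
    expandˡ = solve 8 (λ a b c d e f β γ →
      β :* (a :* d :- b :* c) :+
      ((e :- (β :* a :+ γ :* c)) :* d :+ :- ((f :- (β :* b :+ γ :* d)) :* c)) :=
      e :* d :- f :* c) refl

    on-line : ∀ p q p′ q′ → 0ℚ ≡
      ((q′ ℚ.+ ℚ.- p′) ℚ.* q ℚ.+ (ℚ.- (q ℚ.+ ℚ.- p)) ℚ.* q′) ℚ.-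
      ((q′ ℚ.+ ℚ.- p′) ℚ.* p ℚ.+ (ℚ.- (q ℚ.+ ℚ.- p)) ℚ.* p′)
    on-line = solve 4 (λ p q p′ q′ → con 0ℚ :=
      ((q′ :+ :- p′) :* q :+ (:- (q :+ :- p)) :* q′) :-
      ((q′ :+ :- p′) :* p :+ (:- (q :+ :- p)) :* p′)) refl

    off-line : ∀ p q r p′ q′ r′ →
      ℚ.- ((q ℚ.- p) ℚ.* (r′ ℚ.- p′) ℚ.- (q′ ℚ.- p′) ℚ.* (r ℚ.- p)) ≡
      ((q′ ℚ.+ ℚ.- p′) ℚ.* r ℚ.+ (ℚ.- (q ℚ.+ ℚ.- p)) ℚ.* r′) ℚ.-
      ((q′ ℚ.+ ℚ.- p′) ℚ.* p ℚ.+ (ℚ.- (q ℚ.+ ℚ.- p)) ℚ.* p′)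
    off-line = solve 6 (λ p q r p′ q′ r′ →
      :- ((q :- p) :* (r′ :- p′) :- (q′ :- p′) :* (r :- p)) :=
      ((q′ :+ :- p′) :* r :+ (:- (q :+ :- p)) :* r′) :-
      ((q′ :+ :- p′) :* p :+ (:- (q :+ :- p)) :* p′)) refl

-- Moving the origin to `p` eliminates α. The weights sum to one only up to `≈`, and that error
-- times the bounded sequence of `p` is again null.
null-offset : ∀ x p q r α β γ → x ≈ α * p + β * q + γ * r → α + β + γ ≈ 1ℝ →
  Null (λ n → (seq x n ℚ.- seq p n) ℚ.-
              (seq β n ℚ.* (seq q n ℚ.- seq p n) ℚ.+ seq γ n ℚ.* (seq r n ℚ.- seq p n)))
null-offset x p q r α β γ x≈ sum≈ = null-resp
  (λ n → Rational.offset (seq x n) (seq p n) (seq q n) (seq r n) (seq α n) (seq β n) (seq γ n))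
  (null-+ {λ n → seq x n ℚ.- seq (α * p + β * q + γ * r) n}
          {λ n → (seq α n ℚ.+ seq β n ℚ.+ seq γ n ℚ.- 1ℚ) ℚ.* seq p n} x≈
    (null-* {λ n → seq α n ℚ.+ seq β n ℚ.+ seq γ n ℚ.- 1ℚ} {seq p} sum≈ (cauchy p)))

0<⇒positive : ∀ {x} → 0ℝ < x → Positive (seq x)
0<⇒positive {x} (ε , 0<ε , N , h) =
  ε , 0<ε , N , λ n n≥ → subst (ℚ._≤ seq x n) (ℚₚ.+-identityˡ ε) (h n n≥)

module _ {p q r x : Point} (inside : InInterior p q r x) where
  open InInterior inside
  private
    diff : (Point → ℝ) → Point → Point → ℝ
    diff c s t = c s + - c t
    F₁ F₂ : ℕ → ℚ
    F₁ n = (seq (proj₁ x) n ℚ.- seq (proj₁ p) n) ℚ.-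
           (seq β n ℚ.* (seq (proj₁ q) n ℚ.- seq (proj₁ p) n) ℚ.+ seq γ n ℚ.* (seq (proj₁ r) n ℚ.- seq (proj₁ p) n))
    F₂ n = (seq (proj₂ x) n ℚ.- seq (proj₂ p) n) ℚ.-
           (seq β n ℚ.* (seq (proj₂ q) n ℚ.- seq (proj₂ p) n) ℚ.+ seq γ n ℚ.* (seq (proj₂ r) n ℚ.- seq (proj₂ p) n))
    null₁ : Null F₁
    null₁ = null-offset (proj₁ x) (proj₁ p) (proj₁ q) (proj₁ r) α β γ (proj₁ combination) sum-to-one
    null₂ : Null F₂
    null₂ = null-offset (proj₂ x) (proj₂ p) (proj₂ q) (proj₂ r) α β γ (proj₂ combination) sum-to-one
    scaled : (w : ℝ) → 0ℝ < w → Positive (turn p q r) → Positive (λ n → seq w n ℚ.*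
      ((seq (proj₁ q) n ℚ.- seq (proj₁ p) n) ℚ.* (seq (proj₂ r) n ℚ.- seq (proj₂ p) n) ℚ.-
       (seq (proj₂ q) n ℚ.- seq (proj₂ p) n) ℚ.* (seq (proj₁ r) n ℚ.- seq (proj₁ p) n)))
    scaled w 0<w pos = positive-* {seq w} (0<⇒positive {w} 0<w) (positive-resp (turn-def p q r) pos)
    null-minor : ∀ {f g} (u v : ℝ) → Null f → Null g →
      Null (λ n → f n ℚ.* seq u n ℚ.+ ℚ.- (g n ℚ.* seq v n))
    null-minor {f} {g} u v nf ng = null-+ {λ n → f n ℚ.* seq u n} {λ n → ℚ.- (g n ℚ.* seq v n)}
      (null-* {f} {seq u} nf (cauchy u)) (null-neg {λ n → g n ℚ.* seq v n} (null-* {g} {seq v} ng (cauchy v)))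

  -- Up to a null sequence the new turn is γ times the old one. With `interior-turnˡ`, it places
  -- interior points in the cone at `p`.
  interior-turnʳ : Positive (turn p q r) → Positive (turn p q x)
  interior-turnʳ pos = positive-resp
    (λ n → trans (Rational.expandʳ
        (seq (proj₁ q) n ℚ.- seq (proj₁ p) n) (seq (proj₂ q) n ℚ.- seq (proj₂ p) n)
        (seq (proj₁ r) n ℚ.- seq (proj₁ p) n) (seq (proj₂ r) n ℚ.- seq (proj₂ p) n)
        (seq (proj₁ x) n ℚ.- seq (proj₁ p) n) (seq (proj₂ x) n ℚ.- seq (proj₂ p) n)
        (seq β n) (seq γ n))
      (sym (turn-def p q x n)))
    (positive+null (scaled γ 0<γ pos)
      (null-minor {F₂} {F₁} (diff proj₁ q p) (diff proj₂ q p) null₂ null₁))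

  interior-turnˡ : Positive (turn p q r) → Positive (turn p x r)
  interior-turnˡ pos = positive-resp
    (λ n → trans (Rational.expandˡ
        (seq (proj₁ q) n ℚ.- seq (proj₁ p) n) (seq (proj₂ q) n ℚ.- seq (proj₂ p) n)
        (seq (proj₁ r) n ℚ.- seq (proj₁ p) n) (seq (proj₂ r) n ℚ.- seq (proj₂ p) n)
        (seq (proj₁ x) n ℚ.- seq (proj₁ p) n) (seq (proj₂ x) n ℚ.- seq (proj₂ p) n)
        (seq β n) (seq γ n))
      (sym (turn-def p x r n)))
    (positive+null (scaled β 0<β pos)
      (null-minor {F₁} {F₂} (diff proj₂ r p) (diff proj₁ r p) null₁ null₂))

-- The normal vector is the direction from p to q after a quarter turn, and `d` is chosen so that p
-- satisfies the equation on the nose.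
line-through : ∀ p q → ¬ (p ≈ₚ q) → Line
line-through (p , p′) (q , q′) p≉q = record
  { a = q′ + - p′
  ; b = - (q + - p)
  ; d = (q′ + - p′) * p + (- (q + - p)) * p′
  ; nondegenerate = λ (a≈0 , b≈0) → p≉q
      ( null-resp (λ n → minus-zero (seq p n) (seq q n)) b≈0
      , null-resp (λ n → neg-minus-zero (seq p′ n) (seq q′ n))
          (null-neg {λ n → seq q′ n ℚ.+ ℚ.- seq p′ n ℚ.- 0ℚ} a≈0) )
  }
  where
  open +-*-Solver
  minus-zero : ∀ p q → ℚ.- (q ℚ.+ ℚ.- p) ℚ.- 0ℚ ≡ p ℚ.- q
  minus-zero = solve 2 (λ p q → :- (q :+ :- p) :- con 0ℚ := p :- q) refl
  neg-minus-zero : ∀ p q → ℚ.- ((q ℚ.+ ℚ.- p) ℚ.- 0ℚ) ≡ p ℚ.- q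
  neg-minus-zero = solve 2 (λ p q → :- ((q :+ :- p) :- con 0ℚ) := p :- q) refl

-- The residual of `r` in the equation of the line through `p` and `q` is the negated turn.
null-turn⇒collinear : ∀ {p q r} → ¬ (p ≈ₚ q) → Null (turn p q r) → Collinear p q r
null-turn⇒collinear {P@(p , p′)} {Q@(q , q′)} {R@(r , r′)} p≉q null =
  line-through P Q p≉q ,
  null-resp (λ n → sym (ℚₚ.+-inverseʳ (seq (Line.d (line-through P Q p≉q)) n))) null-0 ,
  null-resp (λ n → Rational.on-line (seq p n) (seq q n) (seq p′ n) (seq q′ n)) null-0 ,
  null-resp (λ n → trans (cong ℚ.-_ (turn-def P Q R n))
      (Rational.off-line (seq p n) (seq q n) (seq r n) (seq p′ n) (seq q′ n) (seq r′ n)))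
    (null-neg {turn P Q R} null)

-- The sign of a real is not decidable, hence the double negation: a turn that is positive in
-- neither order is null, which would force collinearity.
¬¬-turn : ∀ {p q r} → ¬ (p ≈ₚ q) → ¬ Collinear p q r →
  ¬ ¬ (Positive (turn p q r) ⊎ Positive (turn p r q))
¬¬-turn {p} {q} {r} p≉q ¬col f = ¬col (null-turn⇒collinear {p} {q} {r} p≉q
  (signless⇒null {turn p q r} (turn-cauchy p q r) (f ∘ inj₁)
    (λ neg → f (inj₂ (positive-resp (λ n → sym (turn-swap p r q n)) neg)))))

-- From ordered triples to counted triangles

swap₁₂ : ∀ {p q r x} → InInterior p q r x → InInterior q p r x
swap₁₂ {p} {q} {r} {x} inside = record
  { α = β ; β = α ; γ = γ ; 0<α = 0<β ; 0<β = 0<α ; 0<γ = 0<γ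
  ; sum-to-one  = null-resp
      (λ n → cong (λ t → t ℚ.+ seq γ n ℚ.- 1ℚ) (ℚₚ.+-comm (seq α n) (seq β n))) sum-to-one
  ; combination = reorder proj₁ (proj₁ combination) , reorder proj₂ (proj₂ combination)
  }
  where
  open InInterior inside
  reorder : (c : Point → ℝ) →
    c x ≈ α * c p + β * c q + γ * c r → c x ≈ β * c q + α * c p + γ * c r
  reorder c = null-resp (λ n → cong (λ t → seq (c x) n ℚ.- (t ℚ.+ seq γ n ℚ.* seq (c r) n))
    (ℚₚ.+-comm (seq α n ℚ.* seq (c p) n) (seq β n ℚ.* seq (c q) n)))

swap₂₃ : ∀ {p q r x} → InInterior p q r x → InInterior p r q x
swap₂₃ {p} {q} {r} {x} inside = record
  { α = α ; β = γ ; γ = β ; 0<α = 0<α ; 0<β = 0<γ ; 0<γ = 0<β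
  ; sum-to-one  = null-resp
      (λ n → cong (ℚ._- 1ℚ) (rotate (seq α n) (seq β n) (seq γ n))) sum-to-one
  ; combination = reorder proj₁ (proj₁ combination) , reorder proj₂ (proj₂ combination)
  }
  where
  open InInterior inside
  rotate : ∀ a b c → a ℚ.+ b ℚ.+ c ≡ a ℚ.+ c ℚ.+ b
  rotate a b c = trans (ℚₚ.+-assoc a b c)
    (trans (cong (a ℚ.+_) (ℚₚ.+-comm b c)) (sym (ℚₚ.+-assoc a c b)))
  reorder : (c : Point → ℝ) →
    c x ≈ α * c p + β * c q + γ * c r → c x ≈ α * c p + γ * c r + β * c q
  reorder c = null-resp (λ n → cong (λ t → seq (c x) n ℚ.- t)
    (rotate (seq α n ℚ.* seq (c p) n) (seq β n ℚ.* seq (c q) n) (seq γ n ℚ.* seq (c r) n)))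

HasSize-resp : {A : Set} {Q R : Pred A 0ℓ} → (∀ {x} → Q x → R x) → (∀ {x} → R x → Q x) →
  ∀ {k} → HasSize Q k → HasSize R k
HasSize-resp f g (xs , unique , spec , size) = xs , unique ,
  (λ x → mk⇔ (f ∘ Equivalence.to (spec x)) (Equivalence.from (spec x) ∘ g)) , size

orderings : {A : Set} → A × A × A → List (A × A × A)
orderings (i , j , k) =
  (i , j , k) ∷ (i , k , j) ∷ (j , i , k) ∷ (j , k , i) ∷ (k , i , j) ∷ (k , j , i) ∷ []

length-orderings : {A : Set} (ts : List (A × A × A)) →
  length (concatMap orderings ts) ≡ 6 ℕ.* length ts
length-orderings []       = refl
length-orderings (t ∷ ts) = trans (cong (6 ℕ.+_) (length-orderings ts)) (sym (ℕₚ.*-suc 6 (length ts)))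

module _ {c n : ℕ} (P : ColoredPointSet c n) (s : ℕ) where
  open ColoredPointSet P

  MonochromaticAlmostEmpty : Fin n × Fin n × Fin n → Set
  MonochromaticAlmostEmpty (i , j , k) =
    (i ≢ j × i ≢ k × j ≢ k) × (color i ≡ color j × color j ≡ color k) × AtMostInside P s i j k

  private
    M = MonochromaticAlmostEmpty

    M-swap₁₂ : ∀ {i j k} → M (i , j , k) → M (j , i , k)
    M-swap₁₂ ((i≢j , i≢k , j≢k) , (ij , jk) , few) =
      (i≢j ∘ sym , j≢k , i≢k) , (sym ij , trans ij jk) ,
      λ t size → few t (HasSize-resp swap₁₂ swap₁₂ size)

    M-swap₂₃ : ∀ {i j k} → M (i , j , k) → M (i , k , j)
    M-swap₂₃ ((i≢j , i≢k , j≢k) , (ij , jk) , few) =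
      (i≢k , i≢j , j≢k ∘ sym) , (trans ij jk , sym jk) ,
      λ t size → few t (HasSize-resp swap₂₃ swap₂₃ size)

    ≢⇒<⊎> : ∀ {i j : Fin n} → i ≢ j → i Fin.< j ⊎ j Fin.< i
    ≢⇒<⊎> {i} {j} i≢j with Finₚ.<-cmp i j
    ... | tri< lt _ _ = inj₁ lt
    ... | tri≈ _ eq _ = contradiction eq i≢j
    ... | tri> _ _ gt = inj₂ gt

    ordered : ∀ {i j k} → i Fin.< j → j Fin.< k → M (i , j , k) → Counted P s (i , j , k)
    ordered i<j j<k (_ , colors , few) = (i<j , j<k) , colors , few

  -- Fan triples start at their pivot and follow orientation, whereas `Counted` wants increasing
  -- indices. Adjacent swaps preserve `M` and generate all reorderings.
  count-once : ∀ {t} → M t → ∃ λ u → Counted P s u × t ∈ orderings u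
  count-once {i , j , k} m@((i≢j , i≢k , j≢k) , _)
    with ≢⇒<⊎> i≢j | ≢⇒<⊎> j≢k | ≢⇒<⊎> i≢k
  ... | inj₁ ij | inj₁ jk | _       = _ , ordered ij jk m , here refl
  ... | inj₁ ij | inj₂ kj | inj₁ ik = _ , ordered ik kj (M-swap₂₃ m) , there (here refl)
  ... | inj₁ ij | inj₂ kj | inj₂ ki =
    _ , ordered ki ij (M-swap₁₂ (M-swap₂₃ m)) , there (there (there (here refl)))
  ... | inj₂ ji | inj₁ jk | inj₁ ik = _ , ordered ji ik (M-swap₁₂ m) , there (there (here refl))
  ... | inj₂ ji | inj₁ jk | inj₂ ki =
    _ , ordered jk ki (M-swap₂₃ (M-swap₁₂ m)) , there (there (there (there (here refl))))
  ... | inj₂ ji | inj₂ kj | _       =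
    _ , ordered kj ji (M-swap₂₃ (M-swap₁₂ (M-swap₂₃ m))) ,
    there (there (there (there (there (here refl)))))

  -- By `count-once` the triples of `ts` all occur among the six orderings of each counted triangle.
  few-triangles : ∀ {k} → XOf P s k → ∀ {ts} → Unique ts → All M ts → length ts ℕ.≤ 6 ℕ.* k
  few-triangles (us , _ , spec , refl) {ts} unique sound =
    subst (length ts ℕ.≤_) (length-orderings us) (⊆⇒length≤ unique λ t∈ →
      let u , counted , t∈u = count-once (All.lookup sound t∈)
      in ∈-concatMap orderings (Equivalence.from (spec u) counted) t∈u)

-- Classical choice of a faithful rational approximation

module _ {s n : ℕ} (P : ColoredPointSet (suc s) n) (gp : GeneralPosition P) where
  open ColoredPointSet P

  private
    Pos : Fin n → Fin n → Fin n → Set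
    Pos i j k = Positive (turn (point i) (point j) (point k))

    PosAt : ℕ → Fin n → Fin n → Fin n → Set
    PosAt N i j k = 0ℚ ℚ.< turn (point i) (point j) (point k) N

    -- The implication runs from real to rational, since a null turn may still have positive terms.
    -- The converse is recovered in `positive` from general position.
    Faithful : Fin n → Fin n → Fin n → ℕ → Set
    Faithful i j k N = Pos i j k → PosAt N i j k

    -- For each triple excluded middle is applied to `Pos`: a positive turn has positive terms from
    -- some index on, and otherwise the implication is vacuous. Finitely many triples share a common
    -- index.
    ¬¬-faithful : ¬ ¬ Eventually (λ N → ∀ i j k → Faithful i j k N)
    ¬¬-faithful f = ¬¬-∀ (λ i → ¬¬-∀ λ j → ¬¬-∀ λ k → single i j k)
      λ e → f (eventually-∀ λ i → eventually-∀ λ j → eventually-∀ λ k → e i j k)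
      where
      single : ∀ i j k → ¬ ¬ Eventually (Faithful i j k)
      single i j k f = ¬¬-excluded-middle λ
        { (yes pos) → f (eventually-map (λ h _ → h)
            (positive⇒eventually {turn (point i) (point j) (point k)} pos))
        ; (no ¬pos) → f (0 , λ _ _ pos → contradiction pos ¬pos) }

    Oriented : Fin n → Fin n → Fin n → Set
    Oriented i j k = i ≢ j → i ≢ k → j ≢ k → Pos i j k ⊎ Pos i k j

    ¬¬-oriented : ¬ ¬ (∀ i j k → Oriented i j k)
    ¬¬-oriented = ¬¬-∀ λ i → ¬¬-∀ λ j → ¬¬-∀ λ k f → f λ i≢j i≢k j≢k →
      ⊥-elim (¬¬-turn {point i} {point j} {point k} (distinct i≢j) (gp i≢j i≢k j≢k)
        (λ o → f λ _ _ _ → o))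

  -- The double negation does no harm, because the real inequality to be proved is itself a
  -- negation.
  quadratic : 8 ℕ.* (suc s ℕ.* suc s) ℕ.≤ n → ∀ {k} → XOf P s k →
    ¬ ¬ (n ℕ.* n ℕ.≤ 2 ℕ.* (suc s ℕ.* suc s ℕ.* suc s) ℕ.* (6 ℕ.* k))
  quadratic large {k} xof f = ¬¬-faithful λ (N , faithful) → ¬¬-oriented λ oriented →
    f (bound N (faithful N ℕₚ.≤-refl) oriented)
    where
    bound : ∀ N → (∀ i j k → Faithful i j k N) → (∀ i j k → Oriented i j k) →
      n ℕ.* n ℕ.≤ 2 ℕ.* (suc s ℕ.* suc s ℕ.* suc s) ℕ.* (6 ℕ.* k)
    bound N faithful oriented =
      let ts , unique , sound , count = C.almostEmpty-triangles general large
      in ℕₚ.≤-trans count (ℕₚ.*-monoʳ-≤ (2 ℕ.* (suc s ℕ.* suc s ℕ.* suc s))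
           (few-triangles P s xof unique (All.map transfer sound)))
      where
      module C = Configuration color (λ i → at (point i) N)
      general : ∀ {p x y} → p ≢ x → p ≢ y → x ≢ y → C.Turn p x y ⊎ C.Turn p y x
      general {p} {x} {y} p≢x p≢y x≢y =
        Sum.map (faithful p x y) (faithful p y x) (oriented p x y p≢x p≢y x≢y)
      -- Were the real turn in the other direction, faithfulness would contradict the asymmetry of
      -- the rational turn.
      positive : ∀ {p x y} → p ≢ x → p ≢ y → x ≢ y → C.Turn p x y → Pos p x y
      positive {p} {x} {y} p≢x p≢y x≢y turn with oriented p x y p≢x p≢y x≢y
      ... | inj₁ pos = pos
      ... | inj₂ neg = ⊥-elim (C.Turn-asym {p} {x} {y} turn (faithful p y x neg))
      -- A point in the open real triangle has its approximation in the rational cone at `p`, so the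
      -- interior points number at most the length of `inCone`.
      transfer : ∀ {t} → C.AlmostEmpty general t → MonochromaticAlmostEmpty P s t
      transfer {p , x , y} ((p≢x , p≢y , x≢y) , colors , turn , few) =
        (p≢x , p≢y , x≢y) , colors , λ { _ (zs , unique , spec , refl) →
          ℕₚ.≤-trans (⊆⇒length≤ unique λ {z} z∈ →
            let inside = Equivalence.to (spec z) z∈
                pos    = positive p≢x p≢y x≢y turn
            in C.∈-inCone p (faithful p x z (interior-turnʳ inside pos))
                            (faithful p z y (interior-turnˡ inside pos))) few }

-- From natural numbers to the real inequality

ι : ℕ → ℚ
ι k = + k ℚ./ 1

private
  toℚᵘ-ι : ∀ k → ℚ.toℚᵘ (ι k) ℚᵘ.≃ ℚᵘ.mkℚᵘ (+ k) 0
  toℚᵘ-ι k = ℚₚ.toℚᵘ-fromℚᵘ (ℚᵘ.mkℚᵘ (+ k) 0)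

-- Rational division normalises fractions, so the computation passes through unnormalised ones.
ι-* : ∀ a b → ι (a ℕ.* b) ≡ ι a ℚ.* ι b
ι-* a b = ℚₚ.toℚᵘ-injective (begin
  ℚ.toℚᵘ (ι (a ℕ.* b))                      ≈⟨ toℚᵘ-ι (a ℕ.* b) ⟩
  ℚᵘ.mkℚᵘ (+ (a ℕ.* b)) 0                   ≡⟨ cong (λ z → ℚᵘ.mkℚᵘ z 0) (ℤₚ.pos-* a b) ⟩
  ℚᵘ.mkℚᵘ (+ a) 0 ℚᵘ.* ℚᵘ.mkℚᵘ (+ b) 0      ≈⟨ ℚᵘₚ.*-cong (toℚᵘ-ι a) (toℚᵘ-ι b) ⟨
  ℚ.toℚᵘ (ι a) ℚᵘ.* ℚ.toℚᵘ (ι b)            ≈⟨ ℚₚ.toℚᵘ-homo-* (ι a) (ι b) ⟨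
  ℚ.toℚᵘ (ι a ℚ.* ι b)                      ∎)
  where open ℚᵘₚ.≃-Reasoning

ι-mono : ∀ {a b} → a ℕ.≤ b → ι a ℚ.≤ ι b
ι-mono {a} {b} a≤b = ℚₚ.toℚᵘ-cancel-≤ (begin
  ℚ.toℚᵘ (ι a)      ≃⟨ toℚᵘ-ι a ⟩
  ℚᵘ.mkℚᵘ (+ a) 0   ≤⟨ ℚᵘ.*≤* (subst₂ ℤ._≤_ (sym (ℤₚ.*-identityʳ (+ a))) (sym (ℤₚ.*-identityʳ (+ b))) (ℤ.+≤+ a≤b)) ⟩
  ℚᵘ.mkℚᵘ (+ b) 0   ≃⟨ toℚᵘ-ι b ⟨
  ℚ.toℚᵘ (ι b)      ∎)
  where open ℚᵘₚ.≤-Reasoning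

scaled-bound : ∀ {i K n m} → 0ℚ ℚ.< i → i ℚ.* ι K ≡ 1ℚ → n ℕ.* n ℕ.≤ K ℕ.* m →
  i ℚ.* (ι n ℚ.* ι n) ℚ.≤ ι m
scaled-bound {i} {K} {n} {m} 0<i i*K≡1 le = begin
  i ℚ.* (ι n ℚ.* ι n)   ≡⟨ cong (i ℚ.*_) (ι-* n n) ⟨
  i ℚ.* ι (n ℕ.* n)     ≤⟨ ℚₚ.*-monoˡ-≤-nonNeg i {{ℚₚ.pos⇒nonNeg i {{ℚ.positive 0<i}}}} (ι-mono le) ⟩
  i ℚ.* ι (K ℕ.* m)     ≡⟨ cong (i ℚ.*_) (ι-* K m) ⟩
  i ℚ.* (ι K ℚ.* ι m)   ≡⟨ ℚₚ.*-assoc i (ι K) (ι m) ⟨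
  (i ℚ.* ι K) ℚ.* ι m   ≡⟨ cong (ℚ._* ι m) i*K≡1 ⟩
  1ℚ ℚ.* ι m            ≡⟨ ℚₚ.*-identityˡ (ι m) ⟩
  ι m                   ∎
  where open ℚₚ.≤-Reasoning

theorem1 : ∀ (c : ℕ) → 2 ℕ.≤ c →
    Σ ℝ λ L → 0ℝ < L ×
    ∃ λ n₀ → ∀ n → n₀ ℕ.≤ n →
    ∀ m → X c (c ∸ 1) n m → L * (fromℕ n * fromℕ n) ≤ fromℕ m
theorem1 (suc s) _ =
  -- `L` is 1/(12c³) with c = `suc s`. Its sequence is constant, so `i` itself serves as the gap in
  -- `0ℝ < L`.
  fromℚ i , (i , 0<i , 0 , λ _ _ → ℚₚ.≤-reflexive (ℚₚ.+-identityˡ i)) ,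
  8 ℕ.* (suc s ℕ.* suc s) , λ n large m ((P , gp , xof) , _) (ε , 0<ε , N , gap) →
    -- The negated inequality supplies ε with ι m + ε ≤ i n². The counting bound gives i n² ≤ ι m, a
    -- contradiction.
    quadratic P gp large xof λ le →
      ℚₚ.<-irrefl refl (ℚₚ.<-≤-trans (increase (ι m) 0<ε)
        (ℚₚ.≤-trans (gap N ℕₚ.≤-refl) (scaled-bound {i} {K} {n} {m} 0<i i*K≡1
          (ℕₚ.≤-trans le (ℕₚ.≤-reflexive (regroup (suc s ℕ.* suc s ℕ.* suc s) m))))))
  where
  -- 12 is 2 · 6: the 2 comes from absorbing the error term, the 6 from the orderings of a triangle.
  K : ℕ
  K = 12 ℕ.* (suc s ℕ.* suc s ℕ.* suc s)
  recip = reciprocal (ι K) (ℚₚ.<-≤-trans (ℚₚ.positive⁻¹ 1ℚ) (ι-mono {1} {K} (s≤s z≤n)))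
  i : ℚ
  i = proj₁ recip
  0<i : 0ℚ ℚ.< i
  0<i = proj₁ (proj₂ recip)
  i*K≡1 : i ℚ.* ι K ≡ 1ℚ
  i*K≡1 = proj₂ (proj₂ recip)
  regroup : ∀ C m → 2 ℕ.* C ℕ.* (6 ℕ.* m) ≡ 12 ℕ.* C ℕ.* m
  regroup = solve-∀
  increase : ∀ q {ε} → 0ℚ ℚ.< ε → q ℚ.< q ℚ.+ ε
  increase q {ε} 0<ε = subst (ℚ._< q ℚ.+ ε) (ℚₚ.+-identityʳ q) (ℚₚ.+-monoʳ-< q 0<ε)
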